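{- Let $G$ be a segment. \begin{enumerate} \item If $G\in\mathcal{C}_=$, then $Ls(G)\in\{2,4\}$ and $Rs(G)\in\{ -2,-4\}$. \item If $G\in\mathcal{C}_-$, then $Ls(G)\in\{1,3\}$ and $Rs(G)\in\{ -1,-3,-5\}$. Moreover, if $|L(G)|$ is odd, then $Ls(G)=3$. \item If $G\in\mathcal{C}_+$, then $Ls(G)\in\{1,3,5\}$ and $Rs(G)\in\{ -1,-3\}$. Moreover, if $|L(G)|$ is even, then $Rs(G)=-3$. \end{enumerate}
   Context: **Game.** A position is a finite directed graph $G=(L\cup R,A)$ whose vertex set $V(G)=L\cup R$ is partitioned into $L=L(G)$ and $R=R(G)$. For $S\subseteq V(G)$, $G\setminus S$ is the subgraph induced on $V(G)\setminus S$. $\mathrm{Succ}(G,x)$ (resp. $\mathrm{Pred}(G,x)$) is the set of vertices reachable from $x$ (resp. that can reach $x$) by a directed path, including $x$. Left and Right alternate; Left chooses $x\in L$ and removes $\mathrm{Succ}(G,x)$, Right chooses $y\in R$ and removes $\mathrm{Pred}(G,y)$; a player's score is the number of vertices he removed. **Relevant graphs.** $\mathrm{Forc}(G)=\{x\in L:\mathrm{Succ}(G,x)\subseteq L\}\cup\{y\in R:\mathrm{Pred}(G,y)\subseteq R\}$ is the set of forced vertices; $G$ is relevant if $\mathrm{Forc}(G)=\emptyset$. Let $\mathcal{S}$ be the class of relevant graphs. On relevant graphs, forced vertices created by a move are immediately given to the player who moved: for $x\in L$, $\mathrm{Rmv}(G,x)=\mathrm{Succ}(G,x)\cup\mathrm{Forc}(G\setminus\mathrm{Succ}(G,x))$;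 for $y\in R$, $\mathrm{Rmv}(G,y)=\mathrm{Pred}(G,y)\cup\mathrm{Forc}(G\setminus\mathrm{Pred}(G,y))$; and $G_u=G\setminus\mathrm{Rmv}(G,u)$, again in $\mathcal{S}$. **Relative scores.** $Ls(G)$ (resp. $Rs(G)$) is Left's score minus Right's score under optimal play when Left (resp. Right) starts: $Ls(\emptyset)=Rs(\emptyset)=0$ and, for nonempty $G\in\mathcal{S}$, $Ls(G)=\max_{x\in L}\{|\mathrm{Rmv}(G,x)|+Rs(G_x)\}$, $Rs(G)=\min_{y\in R}\{ -|\mathrm{Rmv}(G,y)|+Ls(G_y)\}$. **Segments.** A segment is a directed graph whose vertex set is a finite set of at least two consecutive integers, with $L$ the even integers and $R$ the odd integers of this set, and whose arcs are exactly the $(2i,2i+1)$ and $(2i,2i-1)$ having both ends in the vertex set. Segments are relevant. For a segment $G$: $G\in\mathcal{C}_=$ means $|V(G)|$ is even; $G\in\mathcal{C}_+$ means $|V(G)|$ is odd and $|L|-|R|=1$; $G\in\mathcal{C}_-$ means $|V(G)|$ is odd and $|L|-|R|=-1$. -}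

module Defs where

open import Level using (0ℓ)
open import Data.Nat.Base as ℕ using (ℕ; zero; suc)
import Data.Nat.Properties as ℕ
import Data.Nat.Divisibility as ℕ
open import Data.Integer.Base using (ℤ; +_; -_; _+_; _-_; 0ℤ; 1ℤ; -1ℤ; ∣_∣)
import Data.Integer.Properties as ℤ
open import Data.Integer.Divisibility using (_∣_)
open import Data.Fin.Base using (Fin; zero; suc; toℕ)
open import Data.Fin.Properties using (any?)
open import Data.Fin.Subset using (Subset; ⊤; _∈_; _⊆_; ∁; _∩_; _∪_; _─_; Nonempty; Empty)
  renaming (∣_∣ to card)
open import Data.Fin.Subset.Properties
  using (_∈?_; _⊆?_; nonempty?; x∈p∩q⁺; x∈p∩q⁻; x∈p∪q⁺; x∉p⇒x∈∁p; p∩q≢∅⇒∣p─q∣<∣p∣)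
open import Data.List.Base using (List; []; _∷_; map; filter; allFin)
open import Data.List.Extrema ℤ.≤-totalOrder using (max; min)
open import Data.List.Membership.Propositional using () renaming (_∈_ to _∈ₗ_)
open import Data.List.Membership.Propositional.Properties using (∈-filter⁻)
open import Data.List.Relation.Unary.Any using (here; there)
open import Data.Product.Base using (∃; _×_; _,_; proj₁; proj₂)
open import Data.Sum.Base using (_⊎_; inj₁; inj₂)
open import Data.Vec.Base using (tabulate)
open import Data.Vec.Properties using (lookup⇒[]=; []=⇒lookup; lookup∘tabulate)
open import Function.Base using (_∘_; flip)
open import Relation.Binary.Core using (Rel)
open import Relation.Binary.Definitions using (Decidable)
open import Relation.Binary.Construct.Closure.ReflexiveTransitive using (Star; ε; _◅_; _◅◅_)
open import Relation.Binary.PropositionalEquality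
open import Relation.Nullary using (¬_; Dec; yes; no; does; contradiction)
open import Relation.Nullary.Decidable using (map′; _×-dec_; _⊎-dec_; dec-true)
import Relation.Unary as U

private
  variable
    n : ℕ

comprehension : {P : U.Pred (Fin n) 0ℓ} → U.Decidable P → Subset n
comprehension P? = tabulate (does ∘ P?)

∈-comprehension⁺ : {P : U.Pred (Fin n) 0ℓ} (P? : U.Decidable P) →
                   ∀ {x} → P x → x ∈ comprehension P?
∈-comprehension⁺ P? {x} px =
  lookup⇒[]= x _ (trans (lookup∘tabulate (does ∘ P?) x) (dec-true (P? x) px))

∈-comprehension⁻ : {P : U.Pred (Fin n) 0ℓ} (P? : U.Decidable P) →
                   ∀ {x} → x ∈ comprehension P? → P x
∈-comprehension⁻ P? {x} x∈
  with P? x | trans (sym (lookup∘tabulate (does ∘ P?) x)) ([]=⇒lookup x∈)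
... | yes px | _ = px
... | no  _  | ()

-- Reachability on a finite type is decidable, by eliminating one
-- intermediate vertex at a time: Skip R relates i and j when R leads
-- from suc i to suc j either directly or through zero.

Skip : Rel (Fin (suc n)) 0ℓ → Rel (Fin n) 0ℓ
Skip R i j = R (suc i) (suc j) ⊎ (R (suc i) zero × R zero (suc j))

module _ {R : Rel (Fin (suc n)) 0ℓ} where

  unskip : ∀ {i j} → Star (Skip R) i j → Star R (suc i) (suc j)
  unskip ε                    = ε
  unskip (inj₁ r        ◅ rs) = r ◅ unskip rs
  unskip (inj₂ (r , r′) ◅ rs) = r ◅ r′ ◅ unskip rs

  skip : ∀ {i j} → Star R (suc i) (suc j) → Star (Skip R) i j
  skip₀ : ∀ {j} → Star R zero (suc j) → ∃ λ i → R zero (suc i) × Star (Skip R) i j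

  skip ε = ε
  skip (_◅_ {j = zero}  r rs) = let i , r′ , rs′ = skip₀ rs in inj₂ (r , r′) ◅ rs′
  skip (_◅_ {j = suc _} r rs) = inj₁ r ◅ skip rs

  skip₀ (_◅_ {j = zero}  r rs) = skip₀ rs
  skip₀ (_◅_ {j = suc i} r rs) = i , r , skip rs

  skip¹ : ∀ {i} → Star R (suc i) zero → ∃ λ j → Star (Skip R) i j × R (suc j) zero
  skip¹ (_◅_ {j = zero}  r rs) = _ , ε , r
  skip¹ (_◅_ {j = suc _} r rs) = let j , rs′ , r′ = skip¹ rs in j , inj₁ r ◅ rs′ , r′

star? : {R : Rel (Fin n) 0ℓ} → Decidable R → Decidable (Star R)
star? {suc n} {R} R? = go
  where
  rec : Decidable (Star (Skip R))
  rec = star? λ i j → R? (suc i) (suc j) ⊎-dec (R? (suc i) zero ×-dec R? zero (suc j))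

  go : Decidable (Star R)
  go zero    zero    = yes ε
  go zero    (suc j) = map′ (λ (_ , r , rs) → r ◅ unskip rs) skip₀
                            (any? λ i → R? zero (suc i) ×-dec rec i j)
  go (suc i) zero    = map′ (λ (_ , rs , r) → unskip rs ◅◅ r ◅ ε) skip¹
                            (any? λ j → rec i j ×-dec R? (suc j) zero)
  go (suc i) (suc j) = map′ unskip skip (rec i j)

-- A position: the digraph induced by _⟶_ on the vertex set V.  The ambient
-- type Fin n, the set left and the relation _⟶_ stay the same throughout a
-- game; only their restrictions to V are meaningful.

record Graph (n : ℕ) : Set₁ where
  field
    V    : Subset n
    left : Subset n
    _⟶_  : Rel (Fin n) 0ℓ
    _⟶?_ : Decidable _⟶_

  L R : Subset n
  L = V ∩ left
  R = V ∩ ∁ left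

  Arc : Rel (Fin n) 0ℓ
  Arc x y = x ∈ V × y ∈ V × x ⟶ y

  arc? : Decidable Arc
  arc? x y = (x ∈? V) ×-dec (y ∈? V) ×-dec (x ⟶? y)

  Path : Rel (Fin n) 0ℓ
  Path = Star Arc

  path? : Decidable Path
  path? = star? arc?

open Graph public using (V; L; R; Arc; Path; path?)

infixl 5 _∖_
_∖_ : Graph n → Subset n → Graph n
G ∖ S = record G { V = V G ─ S }

Succ Pred : Graph n → Fin n → Subset n
Succ G x = comprehension (path? G x)
Pred G y = comprehension (flip (path? G) y)

Forced : Graph n → Fin n → Set
Forced G x = (x ∈ L G × Succ G x ⊆ L G) ⊎ (x ∈ R G × Pred G x ⊆ R G)

forced? : (G : Graph n) → U.Decidable (Forced G)
forced? G x = ((x ∈? L G) ×-dec (Succ G x ⊆? L G)) ⊎-dec ((x ∈? R G) ×-dec (Pred G x ⊆? R G))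

Forc : Graph n → Subset n
Forc G = comprehension (forced? G)

Relevant : Graph n → Set
Relevant G = Empty (Forc G)

-- Rmv(G,u) for u in L and for u in R respectively.
Rmvᴸ Rmvᴿ : Graph n → Fin n → Subset n
Rmvᴸ G x = Succ G x ∪ Forc (G ∖ Succ G x)
Rmvᴿ G y = Pred G y ∪ Forc (G ∖ Pred G y)

elements : Subset n → List (Fin n)
elements p = filter (_∈? p) (allFin _)

-- The value 0 on the empty list is only used where a player has no move;
-- for a relevant graph this means that the graph is empty (see
-- relevant⇒L-nonempty and relevant⇒R-nonempty).

maximum minimum : List ℤ → ℤ
maximum []       = 0ℤ
maximum (x ∷ xs) = max x xs
minimum []       = 0ℤ
minimum (x ∷ xs) = min x xs

-- The first argument bounds the number of remaining moves.  The defining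
-- recursion of the relative scores is recovered in Ls-rec and Rs-rec.

ls rs : ℕ → Graph n → ℤ
ls zero    G = 0ℤ
ls (suc k) G = maximum (map (λ x → + card (Rmvᴸ G x) + rs k (G ∖ Rmvᴸ G x)) (elements (L G)))
rs zero    G = 0ℤ
rs (suc k) G = minimum (map (λ y → - (+ card (Rmvᴿ G y)) + ls k (G ∖ Rmvᴿ G y)) (elements (R G)))

Ls Rs : Graph n → ℤ
Ls G = ls (card (V G)) G
Rs G = rs (card (V G)) G

module _ (G : Graph n) where

  Rmvᴸ-decreasing : ∀ {x} → x ∈ L G → card (V (G ∖ Rmvᴸ G x)) ℕ.< card (V G)
  Rmvᴸ-decreasing {x} x∈L = p∩q≢∅⇒∣p─q∣<∣p∣ (V G) (Rmvᴸ G x)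
    (x , x∈p∩q⁺ (proj₁ (x∈p∩q⁻ _ _ x∈L) , x∈p∪q⁺ (inj₁ (∈-comprehension⁺ (path? G x) ε))))

  Rmvᴿ-decreasing : ∀ {y} → y ∈ R G → card (V (G ∖ Rmvᴿ G y)) ℕ.< card (V G)
  Rmvᴿ-decreasing {y} y∈R = p∩q≢∅⇒∣p─q∣<∣p∣ (V G) (Rmvᴿ G y)
    (y , x∈p∩q⁺ (proj₁ (x∈p∩q⁻ _ _ y∈R) ,
                 x∈p∪q⁺ (inj₁ (∈-comprehension⁺ (flip (path? G) y) ε))))

  relevant⇒L-nonempty : Relevant G → Nonempty (V G) → Nonempty (L G)
  relevant⇒L-nonempty rel (x , x∈V) with nonempty? (L G)
  ... | yes ne = ne
  ... | no ¬ne = contradiction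
      (x , ∈-comprehension⁺ (forced? G) (inj₂ (inR x∈V , inR ∘ end ∘ ∈-comprehension⁻ (flip (path? G) x))))
      rel
    where
    inR : ∀ {y} → y ∈ V G → y ∈ R G
    inR y∈V = x∈p∩q⁺ (y∈V , x∉p⇒x∈∁p λ y∈left → ¬ne (_ , x∈p∩q⁺ (y∈V , y∈left)))

    end : ∀ {y} → Path G y x → y ∈ V G
    end ε                 = x∈V
    end ((y∈V , _) ◅ _) = y∈V

  relevant⇒R-nonempty : Relevant G → Nonempty (V G) → Nonempty (R G)
  relevant⇒R-nonempty rel (x , x∈V) with nonempty? (R G)
  ... | yes ne = ne
  ... | no ¬ne = contradiction
      (x , ∈-comprehension⁺ (forced? G) (inj₁ (inL x∈V , inL ∘ end x∈V ∘ ∈-comprehension⁻ (path? G x))))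
      rel
    where
    inL : ∀ {y} → y ∈ V G → y ∈ L G
    inL {y} y∈V with y ∈? Graph.left G
    ... | yes y∈left = x∈p∩q⁺ (y∈V , y∈left)
    ... | no  y∉left = contradiction (y , x∈p∩q⁺ (y∈V , x∉p⇒x∈∁p y∉left)) ¬ne

    end : ∀ {x y} → x ∈ V G → Path G x y → y ∈ V G
    end x∈V ε                       = x∈V
    end _   ((_ , y∈V , _) ◅ path) = end y∈V path

private
  map-cong-∈ : ∀ {A B : Set} {f g : A → B} (xs : List A) →
               (∀ {x} → x ∈ₗ xs → f x ≡ g x) → map f xs ≡ map g xs
  map-cong-∈ []       eq = refl
  map-cong-∈ (x ∷ xs) eq = cong₂ _∷_ (eq (here refl)) (map-cong-∈ xs (eq ∘ there))

  noElements : (p : Subset n) → Empty p → elements p ≡ []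
  noElements p empty with elements p in eq
  ... | []     = refl
  ... | x ∷ xs = contradiction
    (x , proj₂ (∈-filter⁻ (_∈? p) {xs = allFin _} (subst (x ∈ₗ_) (sym eq) (here refl)))) empty

  fromElements : (p : Subset n) → ∀ {x} → x ∈ₗ elements p → x ∈ p
  fromElements p = proj₂ ∘ ∈-filter⁻ (_∈? p) {xs = allFin _}

ls-bound : ∀ k (G : Graph n) → card (V G) ℕ.≤ k →
           ls (suc k) G ≡ ls k G
rs-bound : ∀ k (G : Graph n) → card (V G) ℕ.≤ k →
           rs (suc k) G ≡ rs k G

ls-bound zero G V≤0 = cong (maximum ∘ map _) (noElements (L G) λ (x , x∈L) →
  ℕ.n≮0 (ℕ.<-≤-trans (Rmvᴸ-decreasing G x∈L) V≤0))
ls-bound (suc k) G V≤1+k = cong maximum (map-cong-∈ (elements (L G)) λ {x} x∈ →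
  cong (_+_ (+ card (Rmvᴸ G x))) (rs-bound k (G ∖ Rmvᴸ G x) (ℕ.s≤s⁻¹
    (ℕ.<-≤-trans (Rmvᴸ-decreasing G (fromElements (L G) x∈)) V≤1+k))))

rs-bound zero G V≤0 = cong (minimum ∘ map _) (noElements (R G) λ (y , y∈R) →
  ℕ.n≮0 (ℕ.<-≤-trans (Rmvᴿ-decreasing G y∈R) V≤0))
rs-bound (suc k) G V≤1+k = cong minimum (map-cong-∈ (elements (R G)) λ {y} y∈ →
  cong (_+_ (- (+ card (Rmvᴿ G y)))) (ls-bound k (G ∖ Rmvᴿ G y) (ℕ.s≤s⁻¹
    (ℕ.<-≤-trans (Rmvᴿ-decreasing G (fromElements (R G) y∈)) V≤1+k))))

private
  ls-Ls : ∀ k (G : Graph n) → card (V G) ℕ.≤′ k → ls k G ≡ Ls G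
  ls-Ls k       G (ℕ.≤′-reflexive refl) = refl
  ls-Ls (suc k) G (ℕ.≤′-step V≤k)       =
    trans (ls-bound k G (ℕ.≤′⇒≤ V≤k)) (ls-Ls k G V≤k)

  rs-Rs : ∀ k (G : Graph n) → card (V G) ℕ.≤′ k → rs k G ≡ Rs G
  rs-Rs k       G (ℕ.≤′-reflexive refl) = refl
  rs-Rs (suc k) G (ℕ.≤′-step V≤k)       =
    trans (rs-bound k G (ℕ.≤′⇒≤ V≤k)) (rs-Rs k G V≤k)

Ls-rec : (G : Graph n) →
         Ls G ≡ maximum (map (λ x → + card (Rmvᴸ G x) + Rs (G ∖ Rmvᴸ G x)) (elements (L G)))
Ls-rec G = trans (sym (ls-bound _ G ℕ.≤-refl))
  (cong maximum (map-cong-∈ (elements (L G)) λ {x} x∈ →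
    cong (_+_ (+ card (Rmvᴸ G x))) (rs-Rs _ (G ∖ Rmvᴸ G x)
      (ℕ.≤⇒≤′ (ℕ.<⇒≤ (Rmvᴸ-decreasing G (fromElements (L G) x∈)))))))

Rs-rec : (G : Graph n) →
         Rs G ≡ minimum (map (λ y → - (+ card (Rmvᴿ G y)) + Ls (G ∖ Rmvᴿ G y)) (elements (R G)))
Rs-rec G = trans (sym (rs-bound _ G ℕ.≤-refl))
  (cong minimum (map-cong-∈ (elements (R G)) λ {y} y∈ →
    cong (_+_ (- (+ card (Rmvᴿ G y)))) (ls-Ls _ (G ∖ Rmvᴿ G y)
      (ℕ.≤⇒≤′ (ℕ.<⇒≤ (Rmvᴿ-decreasing G (fromElements (R G) y∈)))))))

Even : ℤ → Set
Even z = + 2 ∣ z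

even? : U.Decidable Even
even? z = 2 ℕ.∣? ∣ z ∣

-- The vertex set of segment a n consists of a, a + 1, …, a + n − 1, where
-- i : Fin n stands for the integer a + i; it is a segment when n ≥ 2.

module _ (a : ℤ) where

  label : Fin n → ℤ
  label i = a + + toℕ i

  SegmentArc : Rel (Fin n) 0ℓ
  SegmentArc i j = Even (label i) × (label j ≡ label i + 1ℤ ⊎ label j ≡ label i - 1ℤ)

  segmentArc? : Decidable (SegmentArc {n})
  segmentArc? i j = even? (label i) ×-dec
    ((label j ℤ.≟ label i + 1ℤ) ⊎-dec (label j ℤ.≟ label i - 1ℤ))

segment : ℤ → (n : ℕ) → Graph n
segment a n = record
  { V    = ⊤
  ; left = comprehension (even? ∘ label a)
  ; _⟶_  = SegmentArc a
  ; _⟶?_ = segmentArc? a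
  }

C₌ C₊ C₋ : Graph n → Set
C₌ G = 2 ℕ.∣ card (V G)
C₊ G = ¬ 2 ℕ.∣ card (V G) × + card (L G) - + card (R G) ≡ 1ℤ
C₋ G = ¬ 2 ℕ.∣ card (V G) × + card (L G) - + card (R G) ≡ -1ℤ

{-# OPTIONS --safe #-}
module Submission where

-- Let every path of at least two vertices count as a game, and keep as constants
-- the degenerate paths that a move cuts off: a single vertex is worth 1 to its
-- owner, a path of length 0 nothing, and the missing side at an end (a path of
-- length -1) costs the player moving there 1.  Then every move scores exactly 3
-- and splits one path into two.  Write Pₙ and Mₙ for the paths of 2n - 1 vertices
-- with Left's and Right's vertices at the ends and Eₙ for the path of 2n vertices.
--
-- Two strategies for Right, on arbitrary sums of paths, bound Left's score.
-- Playing in a hottest path shows that Left gets at most #P + 4 when starting and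
-- at most #P when not.  Mirroring moves between the two components of
-- Eₙ + Eₙ₊₁, Pₙ₊₁ + Mₙ, Mₙ₊₁ + Eₙ and Mₙ + Eₙ, next to any sum of pairs Z + (-Z),
-- stays inside this family of positions and bounds Left's score by 2, 2, 1 and 1.
-- A middle move of Right reduces a single path to such a position, exchanging the
-- players gives the opposite bounds, and the parity of the score does the rest.

open import Defs
open import Data.Nat.Base using (ℕ; _≤_)
open import Data.Nat.Divisibility using (_∣_)
open import Data.Integer.Base using (ℤ; +_; -_)
open import Data.Fin.Subset using (∣_∣)
open import Data.Product.Base using (_×_)
open import Data.Sum.Base using (_⊎_)
open import Relation.Binary.PropositionalEquality using (_≡_)
open import Relation.Nullary using (¬_)

open import Data.Bool.Base using (Bool; true; false; not; if_then_else_)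
open import Data.Bool.Properties using (not-¬; ¬-not; not-involutive) renaming (_≟_ to _≟ᵇ_)
open import Data.Fin.Base using (Fin; zero; suc; toℕ; fromℕ<)
open import Data.Fin.Properties using (any?; toℕ-injective; toℕ<n; toℕ-fromℕ<)
open import Data.Fin.Subset using (Subset; _∈_; _∉_; _⊆_; _─_; Empty; ⊤)
  renaming (∣_∣ to card)
open import Data.Fin.Subset.Properties using
  ( _∈?_; x∈p∩q⁺; x∈p∩q⁻; x∈p∪q⁺; x∈p∪q⁻; x∉p⇒x∈∁p; x∈∁p⇒x∉p; p─q⊆p; x∈p∧x∉q⇒x∈p─q
  ; drop-there; Empty-unique; ∈⊤; ∣⊤∣≡n; ∣⊥∣≡0 )
open import Data.Integer.Base as ℤ using (-[1+_]; 0ℤ; 1ℤ; -1ℤ)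
import Data.Integer.Properties as ℤ
open import Data.Integer.Tactic.RingSolver using (solve-∀)
open import Data.List.Base using (List; []; _∷_; [_]; _++_; map; foldr; allFin)
open import Data.List.Extrema ℤ.≤-totalOrder
  using (argmax-sel; argmin-sel; ⊥≤max; xs≤max; min≤⊤; min≤xs)
open import Data.List.Membership.Propositional using (find; lose) renaming (_∈_ to _∈ₗ_)
open import Data.List.Membership.Propositional.Properties
  using (∈-∃++; ∈-filter⁺; ∈-filter⁻; ∈-allFin; ∈-map⁺; ∈-map⁻)
open import Data.List.Properties using (++-assoc)
open import Data.List.Relation.Binary.Permutation.Propositional
  using (_↭_; refl; prep; swap; trans; ↭-sym; ↭-reflexive)
open import Data.List.Relation.Binary.Permutation.Propositional.Properties as ↭
  using (∈-resp-↭; All-resp-↭; Any-resp-↭; drop-∷; map⁺; ++⁺ʳ; ↭-empty-inv; ↭-map-inv)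
open import Data.List.Relation.Unary.All as All using (All; []; _∷_)
import Data.List.Relation.Unary.All.Properties as All
open import Data.List.Relation.Unary.AllPairs using (AllPairs; []; _∷_)
open import Data.List.Relation.Unary.Any as Any using (Any; here; there) renaming (_─_ to _─ₗ_)
open import Data.Nat.Base as ℕ using (zero; suc; _+_; _∸_; z≤n; s≤s; ⌊_/2⌋; ⌈_/2⌉)
open import Data.Nat.Divisibility as ℕ using (divides)
open import Data.Nat.ListAction using (sum)
open import Data.Nat.ListAction.Properties using (sum-↭)
import Data.Nat.Properties as ℕ
open import Data.Nat.Tactic.RingSolver renaming (solve-∀ to solve-∀ₙ)
open import Data.Product.Base using (∃; ∃₂; _,_; proj₁; proj₂)
open import Data.Sum.Base as Sum using (inj₁; inj₂; [_,_]′)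
open import Data.Vec.Base using ([]; _∷_; here; there)
open import Function.Base using (_∘_; id)
open import Relation.Binary.Construct.Closure.ReflexiveTransitive using (ε; _◅_)
open import Relation.Binary.Definitions using (tri<; tri≈; tri>)
open import Relation.Binary.PropositionalEquality as ≡ using (_≢_; refl; sym; cong; cong₂; subst)
open import Relation.Nullary using (Dec; yes; no; does; contradiction)
open import Relation.Nullary.Decidable using (_⊎-dec_; _×-dec_; dec-true; dec-false)

-- The hottest-path strategy alone gives all upper bounds on the starter's score, 4 and 5, and with
-- parity the lower bound 1 for the starter who owns both ends of an odd path. In the remaining
-- cases it falls short: it gives the starter at least 0 on an even path and at least -1 on an odd
-- path whose ends are the opponent's, where 2, 1 or 3 is claimed. There the starter has to cut the
-- path near its middle and then copy the opponent's moves.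
--
-- The obstacle is that the two halves are in general not negatives of each other. A copied move
-- makes one new piece cancel, and the other two again differ slightly. The four two-component
-- families are closed under this process, up to symmetric remainders and dead components. Since
-- cancelled pieces accumulate, the strategies are stated for sums of arbitrarily many paths,
-- although the theorem concerns a single one.

-- Lists up to permutation

∷-↭-∷⁻ : ∀ {A : Set} {x y : A} {xs ys} → x ∷ xs ↭ y ∷ ys →
         (x ≡ y × xs ↭ ys) ⊎ ∃ λ zs → xs ↭ y ∷ zs × ys ↭ x ∷ zs
∷-↭-∷⁻ {x = x} {y = y} p with ∈-resp-↭ (↭-sym p) (here refl)
... | here refl = inj₁ (refl , drop-∷ p)
... | there y∈ with as , bs , refl ← ∈-∃++ y∈ =
  inj₂ (as ++ bs , ↭.shift y as bs ,
        drop-∷ (trans (↭-sym p) (trans (prep x (↭.shift y as bs)) (swap x y refl))))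

∈⇒↭ : ∀ {A : Set} {x : A} {xs} (x∈ : x ∈ₗ xs) → xs ↭ x ∷ (xs ─ₗ x∈)
∈⇒↭ (here refl)           = refl
∈⇒↭ (there {x = z} x∈) = trans (prep z (∈⇒↭ x∈)) (swap z _ refl)

-- These four rearrangements regroup the two pieces of a reply and the two pieces of the move it
-- answers into a core followed by a cancelling pair.
↭-zxyw : ∀ {A : Set} {xs} (w x y z : A) → w ∷ x ∷ y ∷ z ∷ xs ↭ z ∷ x ∷ y ∷ w ∷ xs
↭-zxyw w x y z = trans (prep w (prep x (swap y z refl))) (trans (prep w (swap x z refl))
  (trans (swap w z refl) (prep z (trans (swap w x refl) (prep x (swap w y refl))))))

↭-xzyw : ∀ {A : Set} {xs} (w x y z : A) → w ∷ x ∷ y ∷ z ∷ xs ↭ x ∷ z ∷ y ∷ w ∷ xs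
↭-xzyw w x y z = trans (swap w x refl) (prep x (trans (prep w (swap y z refl))
  (trans (swap w z refl) (prep z (swap w y refl)))))

↭-ywxz : ∀ {A : Set} {xs} (w x y z : A) → w ∷ x ∷ y ∷ z ∷ xs ↭ y ∷ w ∷ x ∷ z ∷ xs
↭-ywxz w x y z = trans (prep w (swap x y refl)) (swap w y refl)

↭-wzxy : ∀ {A : Set} {xs} (w x y z : A) → w ∷ x ∷ y ∷ z ∷ xs ↭ w ∷ z ∷ x ∷ y ∷ xs
↭-wzxy w x y z = prep w (trans (prep x (swap y z refl)) (swap x z refl))

-- Sums of paths

-- P n and M n have 2n - 1 vertices, E n has 2n.  In this part a component is seen
-- from Left; later it is seen from either player.

data Comp : Set where
  P M E : ℕ → Comp

data Dead : Comp → Set where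
  P₀ : Dead (P 0)
  P₁ : Dead (P 1)
  M₀ : Dead (M 0)
  M₁ : Dead (M 1)
  E₀ : Dead (E 0)

-- With lengths `2n - 1` for `P` and `M` and `2n` for `E`, the two pieces are together exactly three
-- shorter than the component. No move of Left leaves an `M`, so a single vertex that Left cuts off
-- is always Left's own; this is what allows a forced vertex to be credited by its colour alone.
-- Sums are unordered, so `E→PE` need not record on which side the `P` lies.
data LMove : Comp → Comp → Comp → Set where
  P→PP : ∀ {n} a b → a + b ≡ suc n → LMove (P (2 + n)) (P a) (P b)
  E→PE : ∀ {n} a b → a + b ≡ n     → LMove (E (1 + n)) (P a) (E b)
  M→EE : ∀ {n} a b → a + b ≡ n     → LMove (M (2 + n)) (E a) (E b)

neg : Comp → Comp
neg (P n) = M n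
neg (M n) = P n
neg (E n) = E n

RMove : Comp → Comp → Comp → Set
RMove c d e = LMove (neg c) (neg d) (neg e)

score : Comp → ℤ
score (P 0) = -1ℤ
score (P 1) = 1ℤ
score (M 0) = 1ℤ
score (M 1) = -1ℤ
score _     = 0ℤ

size : Comp → ℕ
size (P n) = n
size (M n) = n
size (E n) = n

neg-involutive : ∀ c → neg (neg c) ≡ c
neg-involutive (P _) = refl
neg-involutive (M _) = refl
neg-involutive (E _) = refl

score-neg : ∀ c → score (neg c) ≡ - score c
score-neg (P 0)             = refl
score-neg (P 1)             = refl
score-neg (P (suc (suc _))) = refl
score-neg (M 0)             = refl
score-neg (M 1)             = refl
score-neg (M (suc (suc _))) = refl
score-neg (E _)             = refl

size-neg : ∀ c → size (neg c) ≡ size c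
size-neg (P _) = refl
size-neg (M _) = refl
size-neg (E _) = refl

mirror : ∀ {c d e} → LMove c d e → RMove (neg c) (neg d) (neg e)
mirror {c} {d} {e} m rewrite neg-involutive c | neg-involutive d | neg-involutive e = m

Dead⇒¬LMove : ∀ {c d e} → Dead c → ¬ LMove c d e
Dead⇒¬LMove () (P→PP _ _ _)
Dead⇒¬LMove () (E→PE _ _ _)
Dead⇒¬LMove () (M→EE _ _ _)

LMove-size : ∀ {c d e} → LMove c d e → size d + size e ℕ.< size c
LMove-size (P→PP a b eq) = s≤s (ℕ.≤-reflexive eq)
LMove-size (E→PE a b eq) = s≤s (ℕ.≤-reflexive eq)
LMove-size (M→EE a b eq) = ℕ.m≤n⇒m≤1+n (s≤s (ℕ.≤-reflexive eq))

RMove-size : ∀ {c d e} → RMove c d e → size d + size e ℕ.< size c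
RMove-size {c} {d} {e} m
  rewrite sym (size-neg c) | sym (size-neg d) | sym (size-neg e) = LMove-size m

∑ : (Comp → ℤ) → List Comp → ℤ
∑ f = foldr (λ c → ℤ._+_ (f c)) 0ℤ

∑-↭ : ∀ (f : Comp → ℤ) {X Y} → X ↭ Y → ∑ f X ≡ ∑ f Y
∑-↭ f refl         = refl
∑-↭ f (prep c p)   = cong (ℤ._+_ (f c)) (∑-↭ f p)
∑-↭ f (swap c d p) rewrite ∑-↭ f p = swap-+ (f c) (f d) _
  where
  swap-+ : ∀ i j k → i ℤ.+ (j ℤ.+ k) ≡ j ℤ.+ (i ℤ.+ k)
  swap-+ = solve-∀
∑-↭ f (trans p q)  = ≡.trans (∑-↭ f p) (∑-↭ f q)

∑-mono : ∀ {f g : Comp → ℤ} → (∀ c → f c ℤ.≤ g c) → ∀ X → ∑ f X ℤ.≤ ∑ g X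
∑-mono f≤g []      = ℤ.≤-refl
∑-mono f≤g (c ∷ X) = ℤ.+-mono-≤ (f≤g c) (∑-mono f≤g X)

totalSize : List Comp → ℕ
totalSize = sum ∘ map size

totalSize-++ : ∀ X Y → totalSize Y ℕ.≤ totalSize (X ++ Y)
totalSize-++ []      Y = ℕ.≤-refl
totalSize-++ (c ∷ X) Y = ℕ.m≤n⇒m≤o+n (size c) (totalSize-++ X Y)

totalSize-step : ∀ {X Y c} d e → X ↭ c ∷ Y → size d + size e ℕ.< size c →
                 totalSize (d ∷ e ∷ Y) ℕ.< totalSize X
totalSize-step {X} {Y} {c} d e p lt = begin-strict
  size d + (size e + totalSize Y) ≡⟨ ℕ.+-assoc (size d) (size e) _ ⟨
  size d + size e + totalSize Y   <⟨ ℕ.+-monoˡ-< (totalSize Y) lt ⟩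
  size c + totalSize Y            ≡⟨ sum-↭ (map⁺ size p) ⟨
  totalSize X                     ∎
  where open ℕ.≤-Reasoning

-- X ≤ᴸ w and X ≤ᴿ w: Right can keep Left's relative score on X at most w when
-- Left, respectively Right, starts.

infix 4 _≤ᴸ_ _≤ᴿ_

data _≤ᴸ_ (X : List Comp) (w : ℤ) : Set
data _≤ᴿ_ (X : List Comp) (w : ℤ) : Set

data _≤ᴸ_ X w where
  against : (All Dead X → ∑ score X ℤ.≤ w) →
            (∀ {c d e Y} → X ↭ c ∷ Y → LMove c d e → d ∷ e ∷ Y ≤ᴿ w ℤ.- + 3) →
            X ≤ᴸ w

data _≤ᴿ_ X w where
  over : All Dead X → ∑ score X ℤ.≤ w → X ≤ᴿ w
  play : ∀ {c d e Y} → X ↭ c ∷ Y → RMove c d e → d ∷ e ∷ Y ≤ᴸ w ℤ.+ + 3 → X ≤ᴿ w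

≤ᴸ-resp-↭ : ∀ {X Y w} → X ↭ Y → X ≤ᴸ w → Y ≤ᴸ w
≤ᴸ-resp-↭ p (against dead moves) = against
  (λ D → subst (ℤ._≤ _) (∑-↭ score p) (dead (All-resp-↭ (↭-sym p) D)))
  (moves ∘ trans p)

≤ᴿ-resp-↭ : ∀ {X Y w} → X ↭ Y → X ≤ᴿ w → Y ≤ᴿ w
≤ᴿ-resp-↭ p (over D le)  = over (All-resp-↭ p D) (subst (ℤ._≤ _) (∑-↭ score p) le)
≤ᴿ-resp-↭ p (play q m r) = play (trans (↭-sym p) q) m r

≤ᴸ-mono : ∀ {X v w} → v ℤ.≤ w → X ≤ᴸ v → X ≤ᴸ w
≤ᴿ-mono : ∀ {X v w} → v ℤ.≤ w → X ≤ᴿ v → X ≤ᴿ w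
≤ᴸ-mono v≤w (against dead moves) = against
  (λ D → ℤ.≤-trans (dead D) v≤w)
  (λ p m → ≤ᴿ-mono (ℤ.+-monoˡ-≤ (- + 3) v≤w) (moves p m))
≤ᴿ-mono v≤w (over D le)  = over D (ℤ.≤-trans le v≤w)
≤ᴿ-mono v≤w (play p m r) = play p m (≤ᴸ-mono (ℤ.+-monoˡ-≤ (+ 3) v≤w) r)

-- No move touches a dead component, so its score passes through every strategy as an additive
-- constant.
dead-∷-≤ᴸ : ∀ {c X w} → Dead c → X ≤ᴸ w → c ∷ X ≤ᴸ score c ℤ.+ w
dead-∷-≤ᴿ : ∀ {c X w} → Dead c → X ≤ᴿ w → c ∷ X ≤ᴿ score c ℤ.+ w
dead-∷-≤ᴸ {c} {X} {w} Dc (against dead moves) = against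
  (λ { (_ ∷ D) → ℤ.+-monoʳ-≤ (score c) (dead D) }) moves′
  where
  moves′ : ∀ {b d e Y} → c ∷ X ↭ b ∷ Y → LMove b d e → d ∷ e ∷ Y ≤ᴿ score c ℤ.+ w ℤ.- + 3
  moves′ {d = d} {e} p m with ∷-↭-∷⁻ p
  ... | inj₁ (refl , _)   = contradiction m (Dead⇒¬LMove Dc)
  ... | inj₂ (Z , q , q′) = ≤ᴿ-resp-↭
    (trans (swap c d refl) (prep d (trans (swap c e refl) (prep e (↭-sym q′)))))
    (≤ᴿ-mono (ℤ.≤-reflexive (sym (ℤ.+-assoc (score c) w (- + 3)))) (dead-∷-≤ᴿ Dc (moves q m)))
dead-∷-≤ᴿ {c} Dc (over D le) = over (Dc ∷ D) (ℤ.+-monoʳ-≤ (score c) le)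
dead-∷-≤ᴿ {c} {X} {w} Dc (play {b} {d} {e} {Y} p m r) = play
  (trans (prep c p) (swap c b refl)) m
  (≤ᴸ-resp-↭ (trans (swap c d refl) (prep d (swap c e refl)))
    (≤ᴸ-mono (ℤ.≤-reflexive (sym (ℤ.+-assoc (score c) w (+ 3)))) (dead-∷-≤ᴸ Dc r)))

-- Left's score on X is at most the total weight when Right starts, and exceeds it
-- by at most the largest temp when Left starts.

weight : Comp → ℤ
weight (P 0)             = -1ℤ
weight (P (suc _))       = 1ℤ
weight (M 0)             = 1ℤ
weight (M 1)             = -1ℤ
weight (M (suc (suc _))) = 0ℤ
weight (E _)             = 0ℤ

-- The values meet two opposite demands: `temp c` has to cover what Left gains over `weight` by
-- moving in `c` (`LMove-weight`), and it has to be small enough for Right to make up for it by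
-- moving in `c` himself (`Cooling`).
temp : Comp → ℕ
temp (P 0)                   = 0
temp (P 1)                   = 0
temp (P (suc (suc _)))       = 4
temp (M 0)                   = 0
temp (M 1)                   = 0
temp (M 2)                   = 3
temp (M (suc (suc (suc _)))) = 4
temp (E 0)                   = 0
temp (E 1)                   = 2
temp (E (suc (suc _)))       = 4

score≤weight : ∀ c → score c ℤ.≤ weight c
score≤weight (P 0)             = ℤ.≤-refl
score≤weight (P 1)             = ℤ.≤-refl
score≤weight (P (suc (suc _))) = ℤ.+≤+ z≤n
score≤weight (M 0)             = ℤ.≤-refl
score≤weight (M 1)             = ℤ.≤-refl
score≤weight (M (suc (suc _))) = ℤ.≤-refl
score≤weight (E _)             = ℤ.≤-refl

weight-P≤1 : ∀ n → weight (P n) ℤ.≤ 1ℤ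
weight-P≤1 zero    = ℤ.-≤+
weight-P≤1 (suc _) = ℤ.≤-refl

weight-M≤0 : ∀ n → weight (M (suc n)) ℤ.≤ 0ℤ
weight-M≤0 zero    = ℤ.-≤+
weight-M≤0 (suc _) = ℤ.≤-refl

temp≤4 : ∀ c → temp c ℕ.≤ 4
temp≤4 (P 0)                   = z≤n
temp≤4 (P 1)                   = z≤n
temp≤4 (P (suc (suc _)))       = ℕ.≤-refl
temp≤4 (M 0)                   = z≤n
temp≤4 (M 1)                   = z≤n
temp≤4 (M 2)                   = ℕ.n≤1+n 3
temp≤4 (M (suc (suc (suc _)))) = ℕ.≤-refl
temp≤4 (E 0)                   = z≤n
temp≤4 (E 1)                   = s≤s (s≤s z≤n)
temp≤4 (E (suc (suc _)))       = ℕ.≤-refl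

Dead⇒temp≡0 : ∀ {c} → Dead c → temp c ≡ 0
Dead⇒temp≡0 P₀ = refl
Dead⇒temp≡0 P₁ = refl
Dead⇒temp≡0 M₀ = refl
Dead⇒temp≡0 M₁ = refl
Dead⇒temp≡0 E₀ = refl

LMove-weight : ∀ {c d e} → LMove c d e →
               weight d ℤ.+ weight e ℤ.+ + 3 ℤ.≤ weight c ℤ.+ + temp c
LMove-weight (P→PP a b _) = ℤ.+-monoˡ-≤ (+ 3) (ℤ.+-mono-≤ (weight-P≤1 a) (weight-P≤1 b))
LMove-weight {E 1}             (E→PE 0 0 refl) = ℤ.≤-refl
LMove-weight {E (suc (suc _))} (E→PE a b _)    =
  ℤ.+-monoˡ-≤ (+ 3) (ℤ.+-monoˡ-≤ 0ℤ (weight-P≤1 a))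
LMove-weight {M 2}                   (M→EE a b _) = ℤ.≤-refl
LMove-weight {M (suc (suc (suc _)))} (M→EE a b _) = ℤ.+≤+ (ℕ.n≤1+n 3)

LMove-temp : ∀ {c d e} → LMove c d e → temp d ℕ.≤ temp c × temp e ℕ.≤ temp c
LMove-temp (P→PP a b _) = temp≤4 (P a) , temp≤4 (P b)
LMove-temp {E 1}             (E→PE 0 0 refl) = z≤n , z≤n
LMove-temp {E (suc (suc _))} (E→PE a b _)    = temp≤4 (P a) , temp≤4 (E b)
LMove-temp {M 2}                   (M→EE 0 0 refl) = z≤n , z≤n
LMove-temp {M (suc (suc (suc _)))} (M→EE a b _)    = temp≤4 (E a) , temp≤4 (E b)

-- The `+ 3` in `weight-drop` is the score of Right's own move. It pays in advance for the advantage
-- `temp c` that Left may take afterwards.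
record Cooling (c : Comp) : Set where
  constructor cooling
  field
    {d e}       : Comp
    move        : RMove c d e
    weight-drop : weight d ℤ.+ weight e ℤ.+ + temp c ℤ.≤ weight c ℤ.+ + 3
    temp-d      : temp d ℕ.≤ temp c
    temp-e      : temp e ℕ.≤ temp c

-- Where `temp` is 4, Right can lower the weight by at least 1: next to an end of a `P`, leaving
-- only components `E`, or two steps from his own end of an `M` or `E`, which isolates that end as
-- `M 1`. In `M 2` the best split has weight 0 and in `E 1` the only one has weight 1, whence their
-- temperatures 3 and 2.
dead⊎cooling : ∀ c → Dead c ⊎ Cooling c
dead⊎cooling (P 0)             = inj₁ P₀
dead⊎cooling (P 1)             = inj₁ P₁
dead⊎cooling (P (suc (suc n))) = inj₂ (cooling {d = E n} {E 0} (M→EE n 0 (ℕ.+-identityʳ n))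
  ℤ.≤-refl (temp≤4 (E n)) z≤n)
dead⊎cooling (M 0) = inj₁ M₀
dead⊎cooling (M 1) = inj₁ M₁
dead⊎cooling (M 2) = inj₂ (cooling {d = M 0} {M 1} (P→PP 0 1 refl) ℤ.≤-refl z≤n z≤n)
dead⊎cooling (M (suc (suc (suc n)))) = inj₂ (cooling {d = M 1} {M (suc n)} (P→PP 1 (suc n) refl)
  (ℤ.+-monoˡ-≤ (+ 4) (ℤ.+-monoʳ-≤ -1ℤ (weight-M≤0 n))) z≤n (temp≤4 (M (suc n))))
dead⊎cooling (E 0) = inj₁ E₀
dead⊎cooling (E 1) = inj₂ (cooling {d = M 0} {E 0} (E→PE 0 0 refl) ℤ.≤-refl z≤n z≤n)
dead⊎cooling (E (suc (suc n))) = inj₂ (cooling {d = M 1} {E n} (E→PE 1 n refl)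
  ℤ.≤-refl z≤n (temp≤4 (E n)))

Hottest : List Comp → Set
Hottest X = ∃₂ λ c Y → X ↭ c ∷ Y × Cooling c × All (λ b → temp b ℕ.≤ temp c) Y

dead⊎hottest : ∀ X → All Dead X ⊎ Hottest X
dead⊎hottest []      = inj₁ []
dead⊎hottest (c ∷ X) with dead⊎cooling c | dead⊎hottest X
... | inj₁ Dc | inj₁ DX = inj₁ (Dc ∷ DX)
... | inj₂ r  | inj₁ DX =
  inj₂ (c , X , refl , r , All.map (λ Db → ℕ.≤-trans (ℕ.≤-reflexive (Dead⇒temp≡0 Db)) z≤n) DX)
... | inj₁ Dc | inj₂ (b , Y , p , r , le) = inj₂ (b , c ∷ Y , trans (prep c p) (swap c b refl) , r ,
  ℕ.≤-trans (ℕ.≤-reflexive (Dead⇒temp≡0 Dc)) z≤n ∷ le)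
... | inj₂ r′ | inj₂ (b , Y , p , r , le) with ℕ.≤-total (temp c) (temp b)
...   | inj₁ c≤b = inj₂ (b , c ∷ Y , trans (prep c p) (swap c b refl) , r , c≤b ∷ le)
...   | inj₂ b≤c = inj₂ (c , b ∷ Y , prep c p , r′ , b≤c ∷ All.map (λ q → ℕ.≤-trans q b≤c) le)

-- Simultaneous induction on the bound `N` of the total size. Right plays in a hottest component
-- `c`; afterwards no component is hotter than `c`, so Left's next advantage is at most `temp c`,
-- which `weight-drop` has already paid for.
≤ᴸ-temp : ∀ N X t → totalSize X ℕ.< N → All (λ c → temp c ℕ.≤ t) X → X ≤ᴸ ∑ weight X ℤ.+ + t
≤ᴿ-weight : ∀ N X → totalSize X ℕ.< N → X ≤ᴿ ∑ weight X
≤ᴸ-temp (suc N) X t (s≤s lt) temps = against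
  (λ _ → ℤ.≤-trans (∑-mono score≤weight X) (ℤ.i≤i+j _ (+ t)))
  λ {c} {d} {e} {Y} p m →
    ≤ᴿ-mono (drop p m (All.head (All-resp-↭ p temps)))
            (≤ᴿ-weight N (d ∷ e ∷ Y) (ℕ.<-≤-trans (totalSize-step d e p (LMove-size m)) lt))
  where
  regroup : ∀ i j k → i ℤ.+ (j ℤ.+ k) ≡ (i ℤ.+ j ℤ.+ + 3) ℤ.+ (k ℤ.- + 3)
  regroup = solve-∀
  regroup′ : ∀ i j k → (i ℤ.+ j) ℤ.+ (k ℤ.- + 3) ≡ i ℤ.+ k ℤ.+ j ℤ.- + 3
  regroup′ = solve-∀
  drop : ∀ {c d e Y} → X ↭ c ∷ Y → LMove c d e → temp c ℕ.≤ t →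
         ∑ weight (d ∷ e ∷ Y) ℤ.≤ ∑ weight X ℤ.+ + t ℤ.- + 3
  drop {c} {d} {e} {Y} p m tc rewrite ∑-↭ weight p
                                    | regroup (weight d) (weight e) (∑ weight Y)
                                    | sym (regroup′ (weight c) (+ t) (∑ weight Y)) =
    ℤ.+-monoˡ-≤ (∑ weight Y ℤ.- + 3)
      (ℤ.≤-trans (LMove-weight m) (ℤ.+-monoʳ-≤ (weight c) (ℤ.+≤+ tc)))
≤ᴿ-weight (suc N) X (s≤s lt) with dead⊎hottest X
... | inj₁ DX = over DX (∑-mono score≤weight X)
... | inj₂ (c , Y , p , cooling {d} {e} m drop td te , tY) = play p m
  (≤ᴸ-mono drop′ (≤ᴸ-temp N (d ∷ e ∷ Y) (temp c)
    (ℕ.<-≤-trans (totalSize-step d e p (RMove-size {c} {d} {e} m)) lt) (td ∷ te ∷ tY)))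
  where
  regroup : ∀ i j k l → i ℤ.+ (j ℤ.+ k) ℤ.+ l ≡ (i ℤ.+ j ℤ.+ l) ℤ.+ k
  regroup = solve-∀
  regroup′ : ∀ i k → i ℤ.+ + 3 ℤ.+ k ≡ i ℤ.+ k ℤ.+ + 3
  regroup′ = solve-∀
  drop′ : ∑ weight (d ∷ e ∷ Y) ℤ.+ + temp c ℤ.≤ ∑ weight X ℤ.+ + 3
  drop′ rewrite ∑-↭ weight p
              | regroup (weight d) (weight e) (∑ weight Y) (+ temp c)
              | sym (regroup′ (weight c) (∑ weight Y)) = ℤ.+-monoˡ-≤ (∑ weight Y) drop

-- The mirror strategy

data Sym : List Comp → Set where
  []   : Sym []
  pair : ∀ s {Z Z′} → Z ↭ s ∷ neg s ∷ Z′ → Sym Z′ → Sym Z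

Sym-++ : ∀ {Y Z} → Sym Y → Sym Z → Sym (Y ++ Z)
Sym-++ []             SZ = SZ
Sym-++ (pair s p SY) SZ = pair s (++⁺ʳ _ p) (Sym-++ SY SZ)

Sym-resp-↭ : ∀ {Y Z} → Y ↭ Z → Sym Y → Sym Z
Sym-resp-↭ p []           with refl ← ↭-empty-inv (↭-sym p) = []
Sym-resp-↭ p (pair s q S) = pair s (trans (↭-sym p) q) S

Sym-∷⁻ : ∀ {c Y Z} → Sym Z → Z ↭ c ∷ Y → ∃ λ Z′ → Y ↭ neg c ∷ Z′ × Sym Z′
Sym-∷⁻ [] p with () ← ↭-empty-inv (↭-sym p)
Sym-∷⁻ (pair s p SZ) q with ∷-↭-∷⁻ (trans (↭-sym p) q)
... | inj₁ (refl , q′) = _ , ↭-sym q′ , SZ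
... | inj₂ (_ , q′ , r) with ∷-↭-∷⁻ q′
...   | inj₁ (refl , q″) = _ , subst (λ c → _ ↭ c ∷ _) (sym (neg-involutive s)) r ,
                           Sym-resp-↭ q″ SZ
...   | inj₂ (_ , q″ , r′) with Z″ , t , S ← Sym-∷⁻ SZ q″ =
  s ∷ neg s ∷ Z″ ,
  trans r (trans (prep s (trans r′ (trans (prep (neg s) t) (swap _ _ refl)))) (swap _ _ refl)) ,
  pair s refl S

∑-score-Sym : ∀ {Z} → Sym Z → ∑ score Z ≡ 0ℤ
∑-score-Sym []                  = refl
∑-score-Sym (pair s {Z′ = Z′} p S) rewrite ∑-↭ score p | score-neg s | ∑-score-Sym S =
  cancel (score s)
  where
  cancel : ∀ i → i ℤ.+ (- i ℤ.+ 0ℤ) ≡ 0ℤ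
  cancel = solve-∀

-- The bounds are dictated by the smallest cases: `PM 0` and `ME 0` are dead with scores 2 and 1,
-- and in `EE 0` Left's only move scores 3 and leaves the constant -1.
data Core : Comp → Comp → ℤ → Set where
  EE  : ∀ i → Core (E i) (E (suc i)) (+ 2)
  PM  : ∀ i → Core (P (suc i)) (M i) (+ 2)
  ME⁺ : ∀ i → Core (M (suc i)) (E i) (+ 1)
  ME  : ∀ i → Core (M i) (E i) (+ 1)

data Balanced (X : List Comp) : ℤ → Set where
  symmetric : Sym X → Balanced X 0ℤ
  core      : ∀ {c k w Z} → Core c k w → X ↭ c ∷ k ∷ Z → Sym Z → Balanced X w

-- Right's answer in k after Left has turned the other component of a core into
-- d and e; when there is none, the result is a symmetric position with Right to
-- move.
data Answer (d e k : Comp) (v : ℤ) : Set where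
  answer : ∀ {d′ e′ x y} s → RMove k d′ e′ → Core x y (v ℤ.+ + 3) →
           (∀ {Z} → d′ ∷ e′ ∷ d ∷ e ∷ Z ↭ x ∷ y ∷ s ∷ neg s ∷ Z) → Answer d e k v
  settle : ∀ J {S} → All Dead J → ∑ score J ℤ.≤ v → Sym S →
           d ∷ e ∷ k ∷ [] ↭ J ++ S → Answer d e k v

-- Right copies the cut in the other component so that one new piece of Left meets its negative; the
-- lengths then force the other two new pieces into a core with the same bound. `EE` and `PM` can
-- turn into each other, and so can `ME` and `ME⁺`, so these families have to be treated together.
core-answer : ∀ {c d e k w} → Core c k w ⊎ Core k c w → LMove c d e → Answer d e k (w ℤ.- + 3)
core-answer (inj₁ (EE _)) (E→PE a b refl) =
  answer (P a) (E→PE a (suc b) (ℕ.+-suc a b)) (EE b) (↭-zxyw _ _ _ _)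
core-answer (inj₂ (EE zero)) (E→PE zero zero refl) =
  settle (P 0 ∷ []) (P₀ ∷ []) ℤ.≤-refl (pair (E 0) refl []) refl
-- Left's piece `E 0` cannot be matched by a shorter `E`. Right therefore matches it exactly, and
-- the difference of one moves to the other pieces, giving a `PM`.
core-answer (inj₂ (EE (suc i))) (E→PE a zero eq) with refl ← ≡.trans (sym (ℕ.+-identityʳ a)) eq =
  answer (E 0) (E→PE i 0 (ℕ.+-identityʳ i)) (PM i) (↭-ywxz _ _ _ _)
core-answer (inj₂ (EE i)) (E→PE a (suc b) eq) with refl ← ≡.trans (sym (ℕ.+-suc a b)) eq =
  answer (P a) (E→PE a b refl) (EE b) (↭-xzyw _ _ _ _)
-- Left took an end vertex, so the shortened `P` is the negative of the untouched `M`. The missing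
-- neighbour, `P 0`, accounts for the whole allowance `2 - 3`.
core-answer (inj₁ (PM (suc m))) (P→PP a zero eq) with refl ← ≡.trans (sym (ℕ.+-identityʳ a)) eq =
  settle (P 0 ∷ []) (P₀ ∷ []) ℤ.≤-refl (pair (P (suc m)) refl []) (swap _ _ refl)
core-answer (inj₁ (PM (suc m))) (P→PP zero b refl) =
  settle (P 0 ∷ []) (P₀ ∷ []) ℤ.≤-refl (pair (P (suc m)) refl []) refl
core-answer (inj₁ (PM (suc m))) (P→PP (suc a) (suc b) eq)
  with refl ← ℕ.suc-injective (≡.trans (sym (cong suc (ℕ.+-suc a b))) eq) =
  answer (P (suc a)) (P→PP (suc a) b refl) (PM b) (↭-zxyw _ _ _ _)
core-answer (inj₂ (PM _)) (M→EE a b refl) =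
  answer (E b) (M→EE (suc a) b refl) (EE a) (trans (↭-ywxz _ _ _ _) (prep _ (prep _ (swap _ _ refl))))
core-answer (inj₁ (ME⁺ _)) (M→EE c d refl) =
  answer (E c) (E→PE d c (ℕ.+-comm d c)) (ME d) (↭-wzxy _ _ _ _)
core-answer (inj₂ (ME⁺ _)) (E→PE a b refl) =
  answer (P a) (P→PP a (suc b) (ℕ.+-suc a b)) (ME⁺ b) (↭-xzyw _ _ _ _)
core-answer (inj₁ (ME _)) (M→EE c d refl) =
  answer (E c) (E→PE (suc d) c (cong suc (ℕ.+-comm d c))) (ME⁺ d) (↭-wzxy _ _ _ _)
-- Right has no reply, as `M 1` is dead: the play is over with constants -1, 0 and -1, exactly
-- `1 - 3`.
core-answer (inj₂ (ME _)) (E→PE {zero} zero zero refl) =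
  settle (P 0 ∷ E 0 ∷ M 1 ∷ []) (P₀ ∷ E₀ ∷ M₁ ∷ []) ℤ.≤-refl [] refl
core-answer (inj₂ (ME _)) (E→PE {suc _} a b eq) =
  answer (P a) (P→PP a b eq) (ME b) (↭-xzyw _ _ _ _)

core-score : ∀ {c k w} → Core c k w → score c ℤ.+ score k ℤ.≤ w
core-score (EE i)               = ℤ.+≤+ z≤n
core-score (PM 0)               = ℤ.≤-refl
core-score (PM 1)               = ℤ.-≤+
core-score (PM (suc (suc i)))   = ℤ.+≤+ z≤n
core-score (ME⁺ 0)              = ℤ.-≤+
core-score (ME⁺ (suc i))        = ℤ.+≤+ z≤n
core-score (ME 0)               = ℤ.≤-refl
core-score (ME 1)               = ℤ.-≤+
core-score (ME (suc (suc i)))   = ℤ.+≤+ z≤n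

Balanced-score : ∀ {X w} → Balanced X w → ∑ score X ℤ.≤ w
Balanced-score (symmetric S) = ℤ.≤-reflexive (∑-score-Sym S)
Balanced-score (core {c} {k} κ p S)
  rewrite ∑-↭ score p | ∑-score-Sym S | ℤ.+-identityʳ (score k) = core-score κ

-- This separates the two kinds of reply: if Left's component belongs to a cancelling pair, Right
-- copies the move literally and any core stays intact; otherwise the component is half of the core
-- and `core-answer` takes over.
Balanced-∷⁻ : ∀ {X Y c w} → Balanced X w → X ↭ c ∷ Y →
  (∃ λ Y′ → Y ↭ neg c ∷ Y′ × ∀ d e → Balanced (neg d ∷ neg e ∷ d ∷ e ∷ Y′) w) ⊎
  (∃₂ λ k Z → (Core c k w ⊎ Core k c w) × Y ↭ k ∷ Z × Sym Z)
Balanced-∷⁻ (symmetric S) p with Z , q , SZ ← Sym-∷⁻ S p =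
  inj₁ (Z , q , λ d e → symmetric (pair d (↭-ywxz _ _ _ _) (pair e (swap _ _ refl) SZ)))
Balanced-∷⁻ (core {b} {k} κ q S) p with ∷-↭-∷⁻ (trans (↭-sym q) p)
... | inj₁ (refl , r) = inj₂ (_ , _ , inj₁ κ , ↭-sym r , S)
... | inj₂ (_ , r , t) with ∷-↭-∷⁻ r
...   | inj₁ (refl , r′) = inj₂ (_ , _ , inj₂ κ , trans t (prep b (↭-sym r′)) , S)
...   | inj₂ (_ , r′ , t′) with Z , v , SZ ← Sym-∷⁻ S r′ =
  inj₁ (b ∷ k ∷ Z ,
        trans t (trans (prep b (trans t′ (trans (prep k v) (swap _ _ refl)))) (swap _ _ refl)) ,
        λ d e → core κ
          (trans (prep _ (trans (prep _ (trans (prep d (swap e b refl)) (swap d b refl))) (swap _ b refl)))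
            (trans (swap _ b refl) (prep b
              (trans (prep _ (trans (prep _ (trans (prep d (swap e k refl)) (swap d k refl))) (swap _ k refl)))
                (swap _ k refl)))))
          (pair d (↭-ywxz _ _ _ _) (pair e (swap _ _ refl) SZ)))

dead-++-≤ᴿ : ∀ {J X w} → All Dead J → X ≤ᴿ w → J ++ X ≤ᴿ ∑ score J ℤ.+ w
dead-++-≤ᴿ {w = w} []        r = ≤ᴿ-mono (ℤ.≤-reflexive (sym (ℤ.+-identityˡ w))) r
dead-++-≤ᴿ {c ∷ J} {w = w} (Dc ∷ D) r =
  ≤ᴿ-mono (ℤ.≤-reflexive (sym (ℤ.+-assoc (score c) _ w))) (dead-∷-≤ᴿ Dc (dead-++-≤ᴿ D r))

Balanced-≤ᴸ : ∀ N {X w} → totalSize X ℕ.< N → Balanced X w → X ≤ᴸ w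
-- Having to move in a symmetric position does not hurt Right. He takes an end vertex of his in one
-- member of a pair, which costs 1 for the missing neighbour (`M 0`) and turns the pair into a `PM`
-- or `EE` core worth at most 2 to Left; together this is the 3 that the move scores.
Sym-≤ᴿ : ∀ N {Z} → totalSize Z ℕ.< N → Sym Z → Z ≤ᴿ 0ℤ
Balanced-≤ᴸ (suc N) {X} {w} (s≤s lt) B = against (λ _ → Balanced-score B) respond
  where
  cancel : ∀ i → i ≡ i ℤ.- + 3 ℤ.+ + 3
  cancel = solve-∀

  respond : ∀ {c d e Y} → X ↭ c ∷ Y → LMove c d e → d ∷ e ∷ Y ≤ᴿ w ℤ.- + 3
  respond {c} {d} {e} {Y} p m with Balanced-∷⁻ B p
  ... | inj₁ (Z , q , B′) = play q′ (mirror m)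
    (Balanced-≤ᴸ N (ℕ.<-trans (totalSize-step (neg d) (neg e) q′ (RMove-size {neg c} {neg d} {neg e} (mirror m)))
                              (ℕ.<-≤-trans (totalSize-step d e p (LMove-size m)) lt))
                 (subst (Balanced _) (cancel w) (B′ d e)))
    where
    q′ : d ∷ e ∷ Y ↭ neg c ∷ d ∷ e ∷ Z
    q′ = trans (prep d (trans (prep e q) (swap e (neg c) refl))) (swap d (neg c) refl)
  ... | inj₂ (k , Z , κ , q , SZ) with core-answer κ m
  ...   | answer {d′} {e′} s m′ κ′ r = play q′ m′
    (Balanced-≤ᴸ N (ℕ.<-trans (totalSize-step d′ e′ q′ (RMove-size {k} {d′} {e′} m′))
                              (ℕ.<-≤-trans (totalSize-step d e p (LMove-size m)) lt))
                 (core κ′ r (pair s refl SZ)))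
    where
    q′ : d ∷ e ∷ Y ↭ k ∷ d ∷ e ∷ Z
    q′ = trans (prep d (trans (prep e q) (swap e k refl))) (swap d k refl)
  ...   | settle J {S} D J≤ SS r = ≤ᴿ-resp-↭ (↭-sym q′)
    (≤ᴿ-mono (ℤ.≤-trans (ℤ.≤-reflexive (ℤ.+-identityʳ _)) J≤)
      (dead-++-≤ᴿ D (Sym-≤ᴿ N size< (Sym-++ SS SZ))))
    where
    q′ : d ∷ e ∷ Y ↭ J ++ (S ++ Z)
    q′ = trans (prep d (prep e q)) (trans (++⁺ʳ Z r) (↭-reflexive (++-assoc J S Z)))
    size< : totalSize (S ++ Z) ℕ.< N
    size< = ℕ.≤-<-trans (ℕ.≤-trans (totalSize-++ J (S ++ Z))
        (ℕ.≤-reflexive (sym (sum-↭ (map⁺ size q′)))))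
      (ℕ.<-≤-trans (totalSize-step d e p (LMove-size m)) lt)
Sym-≤ᴿ (suc N) {Z} (s≤s lt) S with dead⊎hottest Z
... | inj₁ D = over D (ℤ.≤-reflexive (∑-score-Sym S))
... | inj₂ (c , Y , p , r , _) with Z′ , q , S′ ← Sym-∷⁻ S p = break c (trans p (prep c q)) r
  where
  breakPM : ∀ n → Z ↭ M (2 + n) ∷ P (2 + n) ∷ Z′ → Z ≤ᴿ 0ℤ
  breakPM n p = play {d = M 0} {M (suc n)} p (P→PP 0 (suc n) refl)
    (dead-∷-≤ᴸ M₀ (Balanced-≤ᴸ N (ℕ.<-≤-trans (totalSize-step (M 0) (M (suc n)) p ℕ.≤-refl) lt)
      (core (PM (suc n)) (swap _ _ refl) S′)))

  break : ∀ c → Z ↭ c ∷ neg c ∷ Z′ → Cooling c → Z ≤ᴿ 0ℤ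
  break (P (suc (suc n))) p _ = breakPM n (trans p (swap _ _ refl))
  break (M (suc (suc n))) p _ = breakPM n p
  break (E (suc n))       p _ = play {d = M 0} {E n} p (E→PE 0 n refl)
    (dead-∷-≤ᴸ M₀ (Balanced-≤ᴸ N (ℕ.<-≤-trans (totalSize-step (M 0) (E n) p ℕ.≤-refl) lt)
      (core (EE n) refl S′)))
  break (P 0) p (cooling () _ _ _)
  break (P 1) p (cooling () _ _ _)
  break (M 0) p (cooling () _ _ _)
  break (M 1) p (cooling () _ _ _)
  break (E 0) p (cooling () _ _ _)

-- Bounds for a single path

Balanced⇒≤ᴸ : ∀ {X w} → Balanced X w → X ≤ᴸ w
Balanced⇒≤ᴸ = Balanced-≤ᴸ _ ℕ.≤-refl

-- 4 is the largest temperature of any component.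
single-≤ᴸ : ∀ c → [ c ] ≤ᴸ weight c ℤ.+ + 4
single-≤ᴸ c = subst (λ i → [ c ] ≤ᴸ i ℤ.+ + 4) (ℤ.+-identityʳ (weight c))
  (≤ᴸ-temp _ [ c ] 4 ℕ.≤-refl (temp≤4 c ∷ []))

single-≤ᴿ : ∀ c → [ c ] ≤ᴿ weight c
single-≤ᴿ c = subst ([ c ] ≤ᴿ_) (ℤ.+-identityʳ (weight c)) (≤ᴿ-weight _ [ c ] ℕ.≤-refl)

-- In this and the next three bounds Right's cut scores 3 and leaves halves worth at most 0, 2, 1
-- and 1 to Left: a cancelling pair, `EE`, `ME` and `ME⁺`.
P-even-≤ᴿ : ∀ k → [ P (2 + (k + k)) ] ≤ᴿ - + 3
P-even-≤ᴿ k = play {d = E k} {E k} refl (M→EE k k refl)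
  (Balanced⇒≤ᴸ (symmetric (pair (E k) refl [])))

P-odd-≤ᴿ : ∀ k → [ P (3 + (k + k)) ] ≤ᴿ -1ℤ
P-odd-≤ᴿ k = play {d = E k} {E (suc k)} refl (M→EE k (suc k) (ℕ.+-suc k k))
  (Balanced⇒≤ᴸ (core (EE k) refl []))

E-odd-≤ᴿ : ∀ k → [ E (1 + (k + k)) ] ≤ᴿ - + 2
E-odd-≤ᴿ k = play {d = M k} {E k} refl (E→PE k k refl) (Balanced⇒≤ᴸ (core (ME k) refl []))

E-even-≤ᴿ : ∀ k → [ E (2 + (k + k)) ] ≤ᴿ - + 2
E-even-≤ᴿ k = play {d = M (suc k)} {E k} refl (E→PE (suc k) k refl)
  (Balanced⇒≤ᴸ (core (ME⁺ k) refl []))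

-- Subsets and parity

x∈p─q⇒x∉q : ∀ {n} {x : Fin n} (p q : Subset n) → x ∈ p ─ q → x ∉ q
x∈p─q⇒x∉q (_ ∷ p) (true  ∷ q) (there x∈) (there x∈q) = x∈p─q⇒x∉q p q x∈ x∈q
x∈p─q⇒x∉q (_ ∷ p) (false ∷ q) (there x∈) (there x∈q) = x∈p─q⇒x∉q p q x∈ x∈q

2∣n⊎2∣1+n : ∀ n → 2 ℕ.∣ n ⊎ 2 ℕ.∣ suc n
2∣n⊎2∣1+n zero    = inj₁ (2 ℕ.∣0)
2∣n⊎2∣1+n (suc n) with 2∣n⊎2∣1+n n
... | inj₁ d = inj₂ (ℕ.∣m∣n⇒∣m+n ℕ.∣-refl d)
... | inj₂ d = inj₁ d

2∣n⇒2∤1+n : ∀ n → 2 ℕ.∣ n → ¬ 2 ℕ.∣ suc n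
2∣n⇒2∤1+n n d d′ with () ← ℕ.∣1⇒≡1 (ℕ.∣m+n∣m⇒∣n (subst (2 ℕ.∣_) (ℕ.+-comm 1 n) d′) d)

does-not : ∀ {P Q : Set} (P? : Dec P) (Q? : Dec Q) → (P → ¬ Q) → (¬ P → Q) →
           does Q? ≡ not (does P?)
does-not (yes p) Q? p⇒¬q _    = dec-false Q? (p⇒¬q p)
does-not (no ¬p) Q? _    ¬p⇒q = dec-true Q? (¬p⇒q ¬p)

does⇒ : ∀ {P : Set} (P? : Dec P) → does P? ≡ true → P
does⇒ (yes p) _ = p

even-suc : ∀ n → does (2 ℕ.∣? suc n) ≡ not (does (2 ℕ.∣? n))
even-suc n = does-not (2 ℕ.∣? n) (2 ℕ.∣? suc n) (2∣n⇒2∤1+n n)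
  λ ¬d → [ (λ d → contradiction d ¬d) , id ]′ (2∣n⊎2∣1+n n)

even?-+1 : ∀ z → does (even? (z ℤ.+ 1ℤ)) ≡ not (does (even? z))
even?-+1 (+ n)          = ≡.trans (cong (λ m → does (2 ℕ.∣? m)) (ℕ.+-comm n 1)) (even-suc n)
even?-+1 (-[1+ zero ])  = refl
even?-+1 (-[1+ suc n ]) = ≡.trans (sym (not-involutive _)) (cong not (sym (even-suc (suc n))))

-- Segments as graphs

-- The player true is Left.

module _ (a : ℤ) where

  -- Colours are defined for all offsets, not only for vertices, because a degenerate piece may
  -- start beyond the end of the board.
  owner : ℕ → Bool
  owner i = does (even? (a ℤ.+ + i))

  owner-suc : ∀ i → owner (suc i) ≡ not (owner i)
  owner-suc i = ≡.trans (cong (does ∘ even?) (shift-1 a (+ i))) (even?-+1 (a ℤ.+ + i))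
    where
    shift-1 : ∀ b j → b ℤ.+ (1ℤ ℤ.+ j) ≡ b ℤ.+ j ℤ.+ 1ℤ
    shift-1 = solve-∀

Adj Far : ℕ → ℕ → Set
Adj i j = j ≡ suc i ⊎ i ≡ suc j
Far i j = suc i ℕ.< j ⊎ suc j ℕ.< i

Adj-sym : ∀ {i j} → Adj i j → Adj j i
Adj-sym (inj₁ eq) = inj₂ eq
Adj-sym (inj₂ eq) = inj₁ eq

Far-sym : ∀ {i j} → Far i j → Far j i
Far-sym (inj₁ lt) = inj₂ lt
Far-sym (inj₂ lt) = inj₁ lt

adj? : ∀ i j → Dec (Adj i j)
adj? i j = (j ℕ.≟ suc i) ⊎-dec (i ℕ.≟ suc j)

Far⇒¬Adj : ∀ {i j} → Far i j → ¬ Adj i j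
Far⇒¬Adj (inj₁ lt) (inj₁ refl) = ℕ.<-irrefl refl lt
Far⇒¬Adj (inj₁ lt) (inj₂ refl) = ℕ.<⇒≱ lt (ℕ.m≤n⇒m≤1+n (ℕ.n≤1+n _))
Far⇒¬Adj (inj₂ lt) (inj₁ refl) = ℕ.<⇒≱ lt (ℕ.m≤n⇒m≤1+n (ℕ.n≤1+n _))
Far⇒¬Adj (inj₂ lt) (inj₂ refl) = ℕ.<-irrefl refl lt

Far⇒≢ : ∀ {i j} → Far i j → i ≢ j
Far⇒≢ (inj₁ lt) refl = ℕ.<⇒≱ lt (ℕ.n≤1+n _)
Far⇒≢ (inj₂ lt) refl = ℕ.<⇒≱ lt (ℕ.n≤1+n _)

¬Adj⇒Far : ∀ {i j} → ¬ Adj i j → i ≢ j → Far i j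
¬Adj⇒Far {i} {j} ¬adj i≢j with ℕ.<-cmp i j
... | tri< i<j _ _ = inj₁ (ℕ.≤∧≢⇒< i<j (¬adj ∘ inj₁ ∘ sym))
... | tri≈ _ i≡j _ = contradiction i≡j i≢j
... | tri> _ _ j<i = inj₂ (ℕ.≤∧≢⇒< j<i (¬adj ∘ inj₂ ∘ sym))

own : ∀ {n} → Bool → Graph n → Subset n
own true  = L
own false = R

Reach Rmv : ∀ {n} → Bool → Graph n → Fin n → Subset n
Reach true  = Succ
Reach false = Pred
Rmv true  = Rmvᴸ
Rmv false = Rmvᴿ

module _ (a : ℤ) {n : ℕ} where

  -- Deleting vertices from a board is definitionally a board again, so a whole game is followed
  -- through its vertex set `v` alone.
  board : Subset n → Graph n
  board v = record (segment a n) { V = v }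

  private
    variable
      v : Subset n
      x y z : Fin n

  owned : Bool → Fin n → Set
  owned p x = owner a (toℕ x) ≡ p

  left⁻ : x ∈ Graph.left (board v) → owned true x
  left⁻ {x} x∈ = dec-true (even? (label a x)) (∈-comprehension⁻ (even? ∘ label a) x∈)

  left⁺ : owned true x → x ∈ Graph.left (board v)
  left⁺ {x} eq = ∈-comprehension⁺ (even? ∘ label a) (does⇒ (even? (label a x)) eq)

  own⁻ : ∀ p → x ∈ own p (board v) → x ∈ v × owned p x
  own⁻ {v = v} true  x∈ with x∈v , x∈l ← x∈p∩q⁻ v _ x∈ = x∈v , left⁻ {v = v} x∈l
  own⁻ {v = v} false x∈ with x∈v , x∉l ← x∈p∩q⁻ v _ x∈ =
    x∈v , ¬-not (x∈∁p⇒x∉p x∉l ∘ left⁺ {v = v})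

  own⁺ : ∀ p → x ∈ v → owned p x → x ∈ own p (board v)
  own⁺ {v = v} true  x∈v eq = x∈p∩q⁺ (x∈v , left⁺ {v = v} eq)
  own⁺ {v = v} false x∈v eq = x∈p∩q⁺ (x∈v , x∉p⇒x∈∁p λ x∈l →
    not-¬ {false} refl (≡.trans (sym eq) (left⁻ {v = v} x∈l)))

  Adj⇒owned : ∀ {p} → Adj (toℕ x) (toℕ y) → owned p x → owned (not p) y
  Adj⇒owned {x = x} (inj₁ eq) refl = ≡.trans (cong (owner a) eq) (owner-suc a (toℕ x))
  Adj⇒owned {x = x} {y = y} (inj₂ eq) refl = ≡.trans (sym (not-involutive _))
    (cong not (sym (≡.trans (cong (owner a) eq) (owner-suc a (toℕ y)))))

  arc⁻ : Arc (board v) x y → x ∈ v × y ∈ v × owned true x × Adj (toℕ x) (toℕ y)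
  arc⁻ {v} {x} {y} (x∈v , y∈v , e , lab) = x∈v , y∈v , dec-true (even? (label a x)) e , adj lab
    where
    cancel+ : ∀ b i → - b ℤ.+ (b ℤ.+ i) ≡ i
    cancel+ = solve-∀
    cancel : ∀ {i j} → a ℤ.+ i ≡ a ℤ.+ j → i ≡ j
    cancel {i} {j} eq =
      ≡.trans (sym (cancel+ a i)) (≡.trans (cong (ℤ._+_ (- a)) eq) (cancel+ a j))
    shift+ : ∀ b i → b ℤ.+ i ℤ.+ 1ℤ ≡ b ℤ.+ (1ℤ ℤ.+ i)
    shift+ = solve-∀
    shift- : ∀ b i → b ℤ.+ (1ℤ ℤ.+ i) ≡ (b ℤ.+ i) ℤ.+ 1ℤ
    shift- = solve-∀
    minus : ∀ i → i ℤ.- 1ℤ ℤ.+ 1ℤ ≡ i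
    minus = solve-∀
    adj : label a y ≡ label a x ℤ.+ 1ℤ ⊎ label a y ≡ label a x ℤ.- 1ℤ → Adj (toℕ x) (toℕ y)
    adj (inj₁ eq) = inj₁ (ℤ.+-injective (cancel (≡.trans eq (shift+ a (+ toℕ x)))))
    adj (inj₂ eq) = inj₂ (ℤ.+-injective (cancel (sym
      (≡.trans (shift- a (+ toℕ y)) (≡.trans (cong (ℤ._+ 1ℤ) eq) (minus _))))))

  arc⁺ : x ∈ v → y ∈ v → owned true x → Adj (toℕ x) (toℕ y) → Arc (board v) x y
  arc⁺ {x} {v} {y} x∈v y∈v ox adj = x∈v , y∈v , does⇒ (even? (label a x)) ox , lab adj
    where
    plus : ∀ b i → b ℤ.+ (1ℤ ℤ.+ i) ≡ b ℤ.+ i ℤ.+ 1ℤ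
    plus = solve-∀
    minus : ∀ b i → b ℤ.+ i ≡ b ℤ.+ (1ℤ ℤ.+ i) ℤ.- 1ℤ
    minus = solve-∀
    lab : Adj (toℕ x) (toℕ y) → label a y ≡ label a x ℤ.+ 1ℤ ⊎ label a y ≡ label a x ℤ.- 1ℤ
    lab (inj₁ eq) = inj₁ (≡.trans (cong (λ i → a ℤ.+ + i) eq) (plus a (+ toℕ x)))
    lab (inj₂ eq) = inj₂ (≡.trans (minus a (+ toℕ y)) (cong (λ i → a ℤ.+ + i ℤ.- 1ℤ) (sym eq)))

  -- Arcs lead from even to odd integers, so no two of them compose.
  path⁻ : Path (board v) x y → x ≡ y ⊎ (x ∈ v × y ∈ v × owned true x × Adj (toℕ x) (toℕ y))
  path⁻ ε = inj₁ refl
  path⁻ (r ◅ ε) = inj₂ (arc⁻ r)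
  path⁻ {v = v} (r ◅ r′ ◅ _)
    with _ , _ , ox , adj ← arc⁻ {v = v} r | _ , _ , oz , _ ← arc⁻ {v = v} r′ =
    contradiction (≡.trans (sym oz) (Adj⇒owned adj ox)) λ ()

  reach⁻ : ∀ p → y ∈ Reach p (board v) x → y ≡ x ⊎ (y ∈ v × Adj (toℕ x) (toℕ y))
  reach⁻ {v = v} {x} true y∈ with path⁻ {v = v} (∈-comprehension⁻ (path? (board v) x) y∈)
  ... | inj₁ refl              = inj₁ refl
  ... | inj₂ (_ , y∈v , _ , adj) = inj₂ (y∈v , adj)
  reach⁻ {v = v} {x} false y∈ with path⁻ {v = v} (∈-comprehension⁻ (λ w → path? (board v) w x) y∈)
  ... | inj₁ refl              = inj₁ refl
  ... | inj₂ (y∈v , _ , _ , adj) = inj₂ (y∈v , Adj-sym adj)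

  reach-self : ∀ p → x ∈ Reach p (board v) x
  reach-self {x} {v} true  = ∈-comprehension⁺ (path? (board v) x) ε
  reach-self {x} {v} false = ∈-comprehension⁺ (λ w → path? (board v) w x) ε

  reach-adj : ∀ p → x ∈ v → owned p x → y ∈ v → Adj (toℕ x) (toℕ y) → y ∈ Reach p (board v) x
  reach-adj {x} {v} true  x∈v ox y∈v adj =
    ∈-comprehension⁺ (path? (board v) x) (arc⁺ x∈v y∈v ox adj ◅ ε)
  reach-adj {x} {v} false x∈v ox y∈v adj =
    ∈-comprehension⁺ (λ w → path? (board v) w x)
      (arc⁺ y∈v x∈v (Adj⇒owned adj ox) (Adj-sym adj) ◅ ε)

  -- Every neighbour of a vertex has the other colour and is reached from it by the owner's kind of
  -- move, so a forced vertex cannot have one.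
  forced⁻ : y ∈ Forc (board v) → y ∈ v × ∀ {z} → z ∈ v → ¬ Adj (toℕ y) (toℕ z)
  forced⁻ {y} {v} y∈ with ∈-comprehension⁻ (forced? (board v)) y∈
  ... | inj₁ (y∈L , succ⊆L) with y∈v , oy ← own⁻ {v = v} true y∈L =
    y∈v , λ z∈v adj → contradiction
      (≡.trans (sym (Adj⇒owned adj oy))
               (proj₂ (own⁻ {v = v} true (succ⊆L (reach-adj true y∈v oy z∈v adj))))) λ ()
  ... | inj₂ (y∈R , pred⊆R) with y∈v , oy ← own⁻ {v = v} false y∈R =
    y∈v , λ z∈v adj → contradiction
      (≡.trans (sym (Adj⇒owned adj oy))
               (proj₂ (own⁻ {v = v} false (pred⊆R (reach-adj false y∈v oy z∈v adj))))) λ ()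

  forced⁺ : y ∈ v → (∀ {z} → z ∈ v → ¬ Adj (toℕ y) (toℕ z)) → y ∈ Forc (board v)
  forced⁺ {y} {v} y∈v isolated with owner a (toℕ y) in oy
  ... | true = ∈-comprehension⁺ (forced? (board v)) (inj₁ (own⁺ true y∈v oy , only))
    where
    only : Succ (board v) y ⊆ L (board v)
    only z∈ with reach⁻ {v = v} true z∈
    ... | inj₁ refl        = own⁺ true y∈v oy
    ... | inj₂ (z∈v , adj) = contradiction adj (isolated z∈v)
  ... | false = ∈-comprehension⁺ (forced? (board v)) (inj₂ (own⁺ false y∈v oy , only))
    where
    only : Pred (board v) y ⊆ R (board v)
    only z∈ with reach⁻ {v = v} false z∈
    ... | inj₁ refl        = own⁺ false y∈v oy
    ... | inj₂ (z∈v , adj) = contradiction adj (isolated z∈v)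

  rmv⁻ : ∀ p → y ∈ Rmv p (board v) x →
         y ∈ Reach p (board v) x ⊎ y ∈ Forc (board (v ─ Reach p (board v) x))
  rmv⁻ true  = x∈p∪q⁻ _ _
  rmv⁻ false = x∈p∪q⁻ _ _

  rmv⁺ : ∀ p → y ∈ Reach p (board v) x ⊎ y ∈ Forc (board (v ─ Reach p (board v) x)) →
         y ∈ Rmv p (board v) x
  rmv⁺ true  = x∈p∪q⁺
  rmv⁺ false = x∈p∪q⁺

  rmv⊆ : ∀ p → x ∈ v → Rmv p (board v) x ⊆ v
  rmv⊆ {x} {v} p x∈v y∈ with rmv⁻ {v = v} p y∈
  ... | inj₂ y∈F = p─q⊆p v _ (proj₁ (forced⁻ y∈F))
  ... | inj₁ y∈S with reach⁻ p y∈S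
  ...   | inj₁ refl      = x∈v
  ...   | inj₂ (y∈v , _) = y∈v

  move : Bool → Subset n → Fin n → Subset n
  move p v x = v ─ Rmv p (board v) x

  Survivor : Subset n → Fin n → Fin n → Set
  Survivor v x y = y ∈ v × Far (toℕ x) (toℕ y)

  remaining⇒far : ∀ p → x ∈ v → owned p x → y ∈ v ─ Reach p (board v) x → Survivor v x y
  remaining⇒far {x} {v} {y} p x∈v ox y∈ = y∈v , ¬Adj⇒Far
    (λ adj → y∉ (reach-adj p x∈v ox y∈v adj))
    (λ eq → y∉ (subst (_∈ Reach p (board v) x) (toℕ-injective eq) (reach-self p)))
    where
    y∈v = p─q⊆p v _ y∈
    y∉  = x∈p─q⇒x∉q v _ y∈

  far⇒remaining : ∀ p → Survivor v x y → y ∈ v ─ Reach p (board v) x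
  far⇒remaining {v} {x} p (y∈v , far) = x∈p∧x∉q⇒x∈p─q y∈v λ y∈ → case (reach⁻ p y∈)
    where
    case : ¬ (_ ≡ x ⊎ (_ ∈ v × Adj (toℕ x) _))
    case (inj₁ refl)      = Far⇒≢ far refl
    case (inj₂ (_ , adj)) = Far⇒¬Adj far adj

  -- A vertex survives a move iff it and one of its neighbours are far from the
  -- vertex played: forced vertices are the isolated ones.
  move⁻ : ∀ p → x ∈ v → owned p x → y ∈ move p v x →
          Survivor v x y × ∃ λ z → Survivor v x z × Adj (toℕ y) (toℕ z)
  move⁻ {x} {v} {y} p x∈v ox y∈ = remaining⇒far p x∈v ox y∈v′ , neighbour
    where
    v′ = v ─ Reach p (board v) x
    y∉ = x∈p─q⇒x∉q v _ y∈
    y∈v′ : y ∈ v′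
    y∈v′ = x∈p∧x∉q⇒x∈p─q (p─q⊆p v _ y∈) (y∉ ∘ rmv⁺ p ∘ inj₁)
    neighbour : ∃ λ z → Survivor v x z × Adj (toℕ y) (toℕ z)
    neighbour with any? (λ z → (z ∈? v′) ×-dec adj? (toℕ y) (toℕ z))
    ... | yes (z , z∈v′ , adj) = z , remaining⇒far p x∈v ox z∈v′ , adj
    ... | no ¬∃ = contradiction
      (rmv⁺ p (inj₂ (forced⁺ y∈v′ λ z∈ adj → ¬∃ (_ , z∈ , adj)))) y∉

  move⁺ : ∀ p → Survivor v x y → Survivor v x z → Adj (toℕ y) (toℕ z) → y ∈ move p v x
  move⁺ {v} {x} {y} p sy sz adj = x∈p∧x∉q⇒x∈p─q (proj₁ sy) λ y∈ → case (rmv⁻ p y∈)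
    where
    case : ¬ (y ∈ Reach p (board v) x ⊎ y ∈ Forc (board (v ─ Reach p (board v) x)))
    case (inj₁ y∈S) = x∈p─q⇒x∉q v _ (far⇒remaining {v = v} p sy) y∈S
    case (inj₂ y∈F) = proj₂ (forced⁻ {v = v ─ Reach p (board v) x} y∈F)
                            (far⇒remaining p sz) adj

AllPairs-resp-↭ : ∀ {A : Set} {_~_ : A → A → Set} → (∀ {x y} → x ~ y → y ~ x) →
                  ∀ {xs ys} → xs ↭ ys → AllPairs _~_ xs → AllPairs _~_ ys
AllPairs-resp-↭ ~-sym refl         rs                     = rs
AllPairs-resp-↭ ~-sym (prep _ p)   (r ∷ rs)               =
  All-resp-↭ p r ∷ AllPairs-resp-↭ ~-sym p rs
AllPairs-resp-↭ ~-sym (swap _ _ p) ((r ∷ rx) ∷ ry ∷ rs) =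
  (~-sym r ∷ All-resp-↭ p ry) ∷ All-resp-↭ p rx ∷ AllPairs-resp-↭ ~-sym p rs
AllPairs-resp-↭ ~-sym (trans p q)  rs                     =
  AllPairs-resp-↭ ~-sym q (AllPairs-resp-↭ ~-sym p rs)

-- Intervals of vertices as components

half : ∀ k → ∃ λ i → k ≡ i + i ⊎ k ≡ suc (i + i)
half zero = 0 , inj₁ refl
half (suc k) with half k
... | i , inj₁ eq = i , inj₂ (cong suc eq)
... | i , inj₂ eq = suc i , inj₁ (cong suc (≡.trans eq (sym (ℕ.+-suc i i))))

offset : ∀ {s x} → s ℕ.≤ x → ∃ λ i → x ≡ s + (i + i) ⊎ x ≡ suc (s + (i + i))
offset {s} {x} s≤x with half (x ∸ s)
... | i , inj₁ eq = i , inj₁ (≡.trans (sym (ℕ.m+[n∸m]≡n s≤x)) (cong (ℕ._+_ s) eq))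
... | i , inj₂ eq = i , inj₂ (≡.trans (sym (ℕ.m+[n∸m]≡n s≤x))
                               (≡.trans (cong (ℕ._+_ s) eq) (ℕ.+-suc s (i + i))))

half-< : ∀ {i k} → i + i ℕ.< k + k → ∃ λ j → k ≡ suc (i + j)
half-< {i} {k} lt = k ∸ suc i , sym (ℕ.m+[n∸m]≡n i<k)
  where
  i<k : i ℕ.< k
  i<k = ℕ.≰⇒> λ k≤i → ℕ.<⇒≱ lt (ℕ.+-mono-≤ k≤i k≤i)

double-suc : ∀ s i → s + (suc i + suc i) ≡ suc (suc (s + (i + i)))
double-suc = solve-∀ₙ

module _ (a : ℤ) where

  owner-double : ∀ s i → owner a (s + (i + i)) ≡ owner a s
  owner-double s zero    = cong (owner a) (ℕ.+-identityʳ s)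
  owner-double s (suc i) = begin
    owner a (s + (suc i + suc i))     ≡⟨ cong (owner a) (double-suc s i) ⟩
    owner a (suc (suc (s + (i + i)))) ≡⟨ owner-suc a _ ⟩
    not (owner a (suc (s + (i + i)))) ≡⟨ cong not (owner-suc a _) ⟩
    not (not (owner a (s + (i + i)))) ≡⟨ not-involutive _ ⟩
    owner a (s + (i + i))             ≡⟨ owner-double s i ⟩
    owner a s                         ∎
    where
    open ≡.≡-Reasoning

  owner-double-suc : ∀ s i → owner a (suc (s + (i + i))) ≡ not (owner a s)
  owner-double-suc s i = ≡.trans (owner-suc a _) (cong not (owner-double s i))

  owner-2+ : ∀ x → owner a (2 + x) ≡ owner a x
  owner-2+ x = ≡.trans (owner-suc a _) (≡.trans (cong not (owner-suc a x)) (not-involutive _))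

  -- The vertices s, …, u - 2 form the component c, seen from player p.  The shift
  -- of u makes room for P 0 and M 0, of length -1, as the case u = s.
  data Matches (p : Bool) (s u : ℕ) : Comp → Set where
    isP : ∀ {k} → s + (k + k) ≡ u → owner a s ≡ p → Matches p s u (P k)
    isM : ∀ {k} → s + (k + k) ≡ u → owner a s ≡ not p → Matches p s u (M k)
    isE : ∀ {k} → suc (s + (k + k)) ≡ u → Matches p s u (E k)

  Matches-neg : ∀ {p s u c} → Matches p s u c → Matches (not p) s u (neg c)
  Matches-neg {p} (isP len o) = isM len (≡.trans o (sym (not-involutive p)))
  Matches-neg     (isM len o) = isP len o
  Matches-neg     (isE len)   = isE len

  -- The interval has length `u - 1 - s`, so `3 + s ≤ u` says that it has at least two vertices.
  dead⊎live : ∀ {p s u c} → Matches p s u c → Dead c ⊎ 3 + s ℕ.≤ u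
  dead⊎live (isP {0} _ _) = inj₁ P₀
  dead⊎live (isP {1} _ _) = inj₁ P₁
  dead⊎live {s = s} (isP {suc (suc k)} refl _) = inj₂ (subst (3 + s ℕ.≤_) (sym (len s k)) (ℕ.m≤m+n _ _))
    where
    len : ∀ s k → s + (suc (suc k) + suc (suc k)) ≡ (3 + s) + suc (k + k)
    len = solve-∀ₙ
  dead⊎live (isM {0} _ _) = inj₁ M₀
  dead⊎live (isM {1} _ _) = inj₁ M₁
  dead⊎live {s = s} (isM {suc (suc k)} refl _) = inj₂ (subst (3 + s ℕ.≤_) (sym (len s k)) (ℕ.m≤m+n _ _))
    where
    len : ∀ s k → s + (suc (suc k) + suc (suc k)) ≡ (3 + s) + suc (k + k)
    len = solve-∀ₙ
  dead⊎live (isE {0} _) = inj₁ E₀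
  dead⊎live {s = s} (isE {suc k} refl) = inj₂ (subst (3 + s ℕ.≤_) (sym (len s k)) (ℕ.m≤m+n _ _))
    where
    len : ∀ s k → suc (s + (suc k + suc k)) ≡ (3 + s) + (k + k)
    len = solve-∀ₙ

  dead⇒short : ∀ {p s u c} → Dead c → Matches p s u c → u ℕ.≤ 2 + s
  dead⇒short {s = s} P₀ (isP refl _) = ℕ.≤-trans (ℕ.≤-reflexive (ℕ.+-identityʳ s)) (ℕ.m≤n+m s 2)
  dead⇒short {s = s} P₁ (isP refl _) = ℕ.≤-reflexive (ℕ.+-comm s 2)
  dead⇒short {s = s} M₀ (isM refl _) = ℕ.≤-trans (ℕ.≤-reflexive (ℕ.+-identityʳ s)) (ℕ.m≤n+m s 2)
  dead⇒short {s = s} M₁ (isM refl _) = ℕ.≤-reflexive (ℕ.+-comm s 2)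
  dead⇒short {s = s} E₀ (isE refl)   =
    s≤s (ℕ.≤-trans (ℕ.≤-reflexive (ℕ.+-identityʳ s)) (ℕ.n≤1+n s))

  -- By the convention on stops, stopping at `x` makes `x - 2` the last vertex of the first piece,
  -- and the second starts at `x + 2`: precisely `x` and its neighbours disappear. For `x = s` the
  -- first piece has length -1.
  Cut : Bool → ℕ → ℕ → ℕ → Comp → Comp → Set
  Cut p s x u d e = Matches p s x d × Matches p (2 + x) u e

  -- The alternative in the conclusion comes from `E→PE`, which names the `P` first although it may
  -- be the right-hand piece on the board.
  cut : ∀ {p s x u c} → Matches p s u c → 3 + s ℕ.≤ u → s ℕ.≤ x → suc x ℕ.< u → owner a x ≡ p →
        ∃₂ λ d e → Cut p s x u d e × (LMove c d e ⊎ LMove c e d)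
  cut {s = s} (isP {k} refl refl) live s≤x x<u o with offset s≤x
  ... | i , inj₂ refl = contradiction (≡.trans (sym (owner-double-suc s i)) o) (not-¬ refl ∘ sym)
  ... | i , inj₁ refl with half-< {i} {k} (ℕ.+-cancelˡ-< s _ _ (ℕ.<-trans (ℕ.n<1+n _) x<u))
  ...   | j , refl with i + j in eq
  -- Here the component would be the single vertex `P 1`, in which `LMove` has no move.
  ...     | zero  = contradiction (ℕ.≤-trans live (ℕ.≤-reflexive (ℕ.+-comm s 2))) ℕ.1+n≰n
  ...     | suc m = P i , P j ,
    (isP refl refl , isP (≡.trans (len s i j) (cong (λ k → s + (suc k + suc k)) eq))
                         (≡.trans (owner-2+ _) o)) , inj₁ (P→PP i j eq)
    where
    len : ∀ s i j → 2 + (s + (i + i)) + (j + j) ≡ s + (suc (i + j) + suc (i + j))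
    len = solve-∀ₙ
  cut {p} {s} (isM {k} refl os) live s≤x x<u o with offset s≤x
  ... | i , inj₁ refl = contradiction
    (≡.trans (sym o) (≡.trans (owner-double s i) os)) (not-¬ refl)
  ... | i , inj₂ refl with half-< {suc i} {k} (ℕ.+-cancelˡ-< s _ _ (subst (ℕ._< s + (k + k)) (sym (double-suc s i)) x<u))
  ...   | j , refl = E i , E j , (isE refl , isE (len s i j)) , inj₁ (M→EE i j refl)
    where
    len : ∀ s i j → suc (2 + suc (s + (i + i)) + (j + j)) ≡
                    s + (suc (suc (i + j)) + suc (suc (i + j)))
    len = solve-∀ₙ
  cut {p} {s} (isE {k} refl) live s≤x x<u o with offset s≤x
  ... | i , inj₁ refl with half-< {i} {k} (ℕ.+-cancelˡ-< s _ _ (ℕ.s≤s⁻¹ x<u))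
  ...   | j , refl = P i , E j ,
    (isP refl (≡.trans (sym (owner-double s i)) o) , isE (cong suc (len s i j))) ,
    inj₁ (E→PE i j refl)
    where
    len : ∀ s i j → 2 + (s + (i + i)) + (j + j) ≡ s + (suc (i + j) + suc (i + j))
    len = solve-∀ₙ
  cut {p} {s} (isE {k} refl) live s≤x x<u o | i , inj₂ refl
    with half-< {i} {k} (ℕ.+-cancelˡ-< s _ _ (ℕ.<-trans (ℕ.n<1+n _) (ℕ.s≤s⁻¹ x<u)))
  ...   | j , refl = E i , P j , (isE refl , isP (len s i j) (≡.trans (owner-2+ _) o)) ,
    inj₂ (E→PE j i (ℕ.+-comm j i))
    where
    len : ∀ s i j → 2 + suc (s + (i + i)) + (j + j) ≡ suc (s + (suc (i + j) + suc (i + j)))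
    len = solve-∀ₙ

  Uncut : Bool → ℕ → ℕ → Comp → Comp → Set
  Uncut p s u d e = ∃ λ x → s ℕ.≤ x × suc x ℕ.< u × owner a x ≡ p ×
                            (Cut p s x u d e ⊎ Cut p s x u e d)

  uncut : ∀ {p s u c d e} → Matches p s u c → LMove c d e → Uncut p s u d e
  uncut {s = s} (isP {suc (suc k)} refl refl) (P→PP i j eq) = s + (i + i) , ℕ.m≤m+n s _ ,
    subst (2 + (s + (i + i)) ℕ.≤_) len (ℕ.m≤m+n _ _) , owner-double s i ,
    inj₁ (isP refl refl , isP len (≡.trans (owner-2+ _) (owner-double s i)))
    where
    len′ : ∀ s i j → 2 + (s + (i + i)) + (j + j) ≡ s + (suc (i + j) + suc (i + j))
    len′ = solve-∀ₙ
    len : 2 + (s + (i + i)) + (j + j) ≡ s + (suc (suc k) + suc (suc k))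
    len = ≡.trans (len′ s i j) (cong (λ m → s + (suc m + suc m)) eq)
  uncut {p} {s} (isM refl os) (M→EE i j refl) = suc (s + (i + i)) ,
    ℕ.m≤n⇒m≤1+n (ℕ.m≤m+n s _) , subst (3 + (s + (i + i)) ℕ.≤_) (len s i j) (ℕ.m≤n⇒m≤1+n (ℕ.m≤m+n _ _)) ,
    ≡.trans (owner-double-suc s i) (≡.trans (cong not os) (not-involutive p)) ,
    inj₁ (isE refl , isE (len s i j))
    where
    len : ∀ s i j → suc (2 + suc (s + (i + i)) + (j + j)) ≡
                    s + (suc (suc (i + j)) + suc (suc (i + j)))
    len = solve-∀ₙ
  -- Exactly one end of an even path belongs to `p`, and the `P` has to lie on that side.
  uncut {p} {s} (isE refl) (E→PE i j refl) with owner a s ≟ᵇ p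
  ... | yes os = s + (i + i) , ℕ.m≤m+n s _ ,
    subst (2 + (s + (i + i)) ℕ.≤_) (cong suc (len s i j)) (ℕ.m≤n⇒m≤1+n (ℕ.m≤m+n _ _)) ,
    ≡.trans (owner-double s i) os , inj₁ (isP refl os , isE (cong suc (len s i j)))
    where
    len : ∀ s i j → 2 + (s + (i + i)) + (j + j) ≡ s + (suc (i + j) + suc (i + j))
    len = solve-∀ₙ
  ... | no ¬os = suc (s + (j + j)) , ℕ.m≤n⇒m≤1+n (ℕ.m≤m+n s _) ,
    subst (3 + (s + (j + j)) ℕ.≤_) (len s i j) (ℕ.m≤m+n _ _) , ox ,
    inj₂ (isE refl , isP (len s i j) (≡.trans (owner-2+ _) ox))
    where
    ox : owner a (suc (s + (j + j))) ≡ p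
    ox = ≡.trans (owner-double-suc s j) (sym (¬-not (¬os ∘ sym)))
    len : ∀ s i j → 2 + suc (s + (j + j)) + (i + i) ≡ suc (s + (suc (i + j) + suc (i + j)))
    len = solve-∀ₙ

  Matches-neg⁻ : ∀ {p s u} c → Matches (not p) s u (neg c) → Matches p s u c
  Matches-neg⁻ {p} c m = subst (λ q → Matches q _ _ c) (not-involutive p)
    (subst (Matches _ _ _) (neg-involutive c) (Matches-neg m))

  uncut-opponent : ∀ {p s u c d e} → Matches p s u c → RMove c d e →
    ∃ λ x → s ℕ.≤ x × suc x ℕ.< u × owner a x ≡ not p × (Cut p s x u d e ⊎ Cut p s x u e d)
  uncut-opponent {d = d} {e} m r with uncut (Matches-neg m) r
  ... | x , s≤x , x<u , o , inj₁ (m₁ , m₂) =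
    x , s≤x , x<u , o , inj₁ (Matches-neg⁻ d m₁ , Matches-neg⁻ e m₂)
  ... | x , s≤x , x<u , o , inj₂ (m₁ , m₂) =
    x , s≤x , x<u , o , inj₂ (Matches-neg⁻ e m₁ , Matches-neg⁻ d m₂)

-- Counting vertices

card-⊎ : ∀ {n} (p q r : Subset n) → (∀ {x} → x ∈ p → x ∈ q ⊎ x ∈ r) → q ⊆ p → r ⊆ p →
         (∀ {x} → x ∈ q → x ∉ r) → card p ≡ card q + card r
card-⊎ [] [] [] _ _ _ _ = refl
card-⊎ (b ∷ p) (c ∷ q) (d ∷ r) split q⊆p r⊆p disjoint = heads b c d split q⊆p r⊆p disjoint
  where
  tails : card p ≡ card q + card r
  tails = card-⊎ p q r
    (λ x∈ → [ inj₁ ∘ drop-there , inj₂ ∘ drop-there ]′ (split (there x∈)))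
    (drop-there ∘ q⊆p ∘ there) (drop-there ∘ r⊆p ∘ there)
    (λ x∈q x∈r → disjoint (there x∈q) (there x∈r))
  heads : ∀ b c d → (∀ {x} → x ∈ b ∷ p → x ∈ c ∷ q ⊎ x ∈ d ∷ r) → c ∷ q ⊆ b ∷ p → d ∷ r ⊆ b ∷ p →
          (∀ {x} → x ∈ c ∷ q → x ∉ d ∷ r) → card (b ∷ p) ≡ card (c ∷ q) + card (d ∷ r)
  heads _     true  true  _ _ _ disj = contradiction here (disj here)
  heads true  true  false _ _ _ _    = cong suc tails
  heads true  false true  _ _ _ _    = ≡.trans (cong suc tails) (sym (ℕ.+-suc (card q) (card r)))
  heads true  false false split _ _ _ with split here
  ... | inj₁ ()
  ... | inj₂ ()
  heads false true  false _ q⊆p _ _ with () ← q⊆p here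
  heads false false true  _ _ r⊆p _ with () ← r⊆p here
  heads false false false _ _ _ _    = tails

card-─ : ∀ {n} {p q : Subset n} → q ⊆ p → card p ≡ card q + card (p ─ q)
card-─ {p = p} {q} q⊆p = card-⊎ p q (p ─ q) split q⊆p (p─q⊆p p q)
  (λ x∈q x∈ → x∈p─q⇒x∉q p q x∈ x∈q)
  where
  split : ∀ {x} → x ∈ p → x ∈ q ⊎ x ∈ p ─ q
  split {x} x∈p with x ∈? q
  ... | yes x∈q = inj₁ x∈q
  ... | no  x∉q = inj₂ (x∈p∧x∉q⇒x∈p─q x∈p x∉q)

Empty⇒card≡0 : ∀ {n} {p : Subset n} → Empty p → card p ≡ 0
Empty⇒card≡0 {n} empty = ≡.trans (cong card (Empty-unique empty)) (∣⊥∣≡0 n)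

card-interval : ∀ {n} (q : Subset n) s u → u ℕ.≤ suc n →
                (∀ {x} → x ∈ q → s ℕ.≤ toℕ x × suc (toℕ x) ℕ.< u) →
                (∀ {x} → s ℕ.≤ toℕ x → suc (toℕ x) ℕ.< u → x ∈ q) →
                card q ≡ u ∸ suc s
card-interval [] s u u≤ _ _ = sym (ℕ.m≤n⇒m∸n≡0 (ℕ.≤-trans u≤ (s≤s z≤n)))
card-interval (true ∷ q) (suc s) u u≤ out _ with () ← proj₁ (out here)
card-interval (false ∷ q) (suc s) zero u≤ out into =
  card-interval q s zero z≤n (λ x∈ → contradiction (proj₂ (out (there x∈))) λ ()) (λ _ ())
card-interval (false ∷ q) (suc s) (suc u) (s≤s u≤) out into =
  card-interval q s u u≤
    (λ x∈ → let l , r = out (there x∈) in ℕ.s≤s⁻¹ l , ℕ.s≤s⁻¹ r)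
    (λ l r → drop-there (into (s≤s l) (s≤s r)))
card-interval (true ∷ q) zero (suc (suc u)) (s≤s u≤) out into = cong suc
  (card-interval q zero (suc u) u≤
    (λ x∈ → z≤n , ℕ.s≤s⁻¹ (proj₂ (out (there x∈))))
    (λ _ r → drop-there (into z≤n (s≤s r))))
card-interval (false ∷ q) zero (suc (suc u)) u≤ out into with () ← into {zero} z≤n (s≤s (s≤s z≤n))
card-interval (true ∷ q) zero zero u≤ out into with () ← proj₂ (out here)
card-interval (true ∷ q) zero (suc zero) u≤ out into with s≤s () ← proj₂ (out here)
card-interval (false ∷ q) zero zero u≤ out into =
  card-interval q zero zero z≤n (λ x∈ → contradiction (proj₂ (out (there x∈))) λ ()) (λ _ ())
card-interval (false ∷ q) zero (suc zero) u≤ out into =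
  card-interval q zero zero z≤n (λ x∈ → contradiction (proj₂ (out (there x∈))) λ { (s≤s ()) }) (λ _ ())

-- Vertices left in the position: a dead component has none.
len : Comp → ℕ
len (P (suc (suc k))) = 3 + (k + k)
len (P _)             = 0
len (M (suc (suc k))) = 3 + (k + k)
len (M _)             = 0
len (E k)             = k + k

len-neg : ∀ c → len (neg c) ≡ len c
len-neg (P 0)             = refl
len-neg (P 1)             = refl
len-neg (P (suc (suc _))) = refl
len-neg (M 0)             = refl
len-neg (M 1)             = refl
len-neg (M (suc (suc _))) = refl
len-neg (E _)             = refl

-- The score of a degenerate path is the difference between its nominal length and the number of its
-- vertices still on the board, so the sum follows the formula `2k - 1` without exceptions.
len-P : ∀ k → + len (P k) ℤ.+ score (P k) ≡ + (k + k) ℤ.- 1ℤ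
len-P 0             = refl
len-P 1             = refl
len-P (suc (suc k)) = cong +_ (shift k)
  where
  shift : ∀ k → 3 + (k + k) + 0 ≡ suc (k + suc (suc k))
  shift = solve-∀ₙ

-- A move removes three vertices nominally. One more is gained for each single vertex cut off, as it
-- is forced and belongs to the mover, and one is lost for each missing neighbour; this is what the
-- scores of `d` and `e` record.
LMove-len : ∀ {c d e} → LMove c d e →
            + len c ≡ + 3 ℤ.+ score d ℤ.+ score e ℤ.+ (+ len d ℤ.+ + len e)
LMove-len (P→PP {n} a b eq) = ≡.trans (total (+ n) (+ a) (+ b) (cong +_ eq))
  (≡.trans (cong₂ (λ i j → + 3 ℤ.+ i ℤ.+ j) (sym (len-P a)) (sym (len-P b))) (regroup (+ len (P a)) (score (P a)) (+ len (P b)) (score (P b))))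
  where
  regroup : ∀ i j k l → + 3 ℤ.+ (i ℤ.+ j) ℤ.+ (k ℤ.+ l) ≡ + 3 ℤ.+ j ℤ.+ l ℤ.+ (i ℤ.+ k)
  regroup = solve-∀
  total′ : ∀ i j → + 3 ℤ.+ (i ℤ.+ j ℤ.- 1ℤ ℤ.+ (i ℤ.+ j ℤ.- 1ℤ)) ≡
                   + 3 ℤ.+ (i ℤ.+ i ℤ.- 1ℤ) ℤ.+ (j ℤ.+ j ℤ.- 1ℤ)
  total′ = solve-∀
  minus : ∀ i → i ≡ 1ℤ ℤ.+ i ℤ.- 1ℤ
  minus = solve-∀
  total : ∀ i j k → j ℤ.+ k ≡ 1ℤ ℤ.+ i →
          + 3 ℤ.+ (i ℤ.+ i) ≡ + 3 ℤ.+ (j ℤ.+ j ℤ.- 1ℤ) ℤ.+ (k ℤ.+ k ℤ.- 1ℤ)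
  total i j k eq = ≡.trans
    (cong (λ m → + 3 ℤ.+ (m ℤ.+ m)) (≡.trans (minus i) (cong (ℤ._- 1ℤ) (sym eq)))) (total′ j k)
LMove-len (E→PE a b refl) = ≡.trans (total (+ a) (+ b))
  (≡.trans (cong (λ i → + 3 ℤ.+ i ℤ.+ 0ℤ ℤ.+ (+ b ℤ.+ + b)) (sym (len-P a))) (regroup (+ len (P a)) (score (P a)) (+ b ℤ.+ + b)))
  where
  regroup : ∀ i j k → + 3 ℤ.+ (i ℤ.+ j) ℤ.+ 0ℤ ℤ.+ k ≡ + 3 ℤ.+ j ℤ.+ 0ℤ ℤ.+ (i ℤ.+ k)
  regroup = solve-∀
  total : ∀ i j → 1ℤ ℤ.+ (i ℤ.+ j) ℤ.+ (1ℤ ℤ.+ (i ℤ.+ j)) ≡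
                  + 3 ℤ.+ (i ℤ.+ i ℤ.- 1ℤ) ℤ.+ 0ℤ ℤ.+ (j ℤ.+ j)
  total = solve-∀
LMove-len (M→EE a b refl) = total (+ a) (+ b)
  where
  total : ∀ i j → + 3 ℤ.+ (i ℤ.+ j ℤ.+ (i ℤ.+ j)) ≡ + 3 ℤ.+ 0ℤ ℤ.+ 0ℤ ℤ.+ (i ℤ.+ i ℤ.+ (j ℤ.+ j))
  total = solve-∀

RMove-len : ∀ {c} d e → RMove c d e →
            + len c ≡ + 3 ℤ.- score d ℤ.- score e ℤ.+ (+ len d ℤ.+ + len e)
RMove-len {c} d e m
  rewrite sym (score-neg d) | sym (score-neg e) | sym (len-neg c) | sym (len-neg d) | sym (len-neg e)
  = LMove-len m

-- Positions as unions of separated intervals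

record Piece : Set where
  constructor piece
  field
    start stop : ℕ
    comp       : Comp

open Piece

Inside Occupied : ℕ → Piece → Set
Inside   i π = start π ℕ.≤ i × suc i ℕ.< stop π
Occupied i π = Inside i π × 3 + start π ℕ.≤ stop π

occupied? : ∀ i π → Dec (Occupied i π)
occupied? i π = ((start π ℕ.≤? i) ×-dec (suc i ℕ.<? stop π)) ×-dec (3 + start π ℕ.≤? stop π)

Apart : Piece → Piece → Set
Apart π ρ = ∀ i j → Inside i π → Inside j ρ → Far i j

comps : List Piece → List Comp
comps = map comp

Adj⇒live : ∀ {s u i j} → s ℕ.≤ i → s ℕ.≤ j → suc i ℕ.< u → suc j ℕ.< u → Adj i j → 3 + s ℕ.≤ u
Adj⇒live s≤i s≤j i<u j<u (inj₁ refl) = ℕ.≤-trans (s≤s (s≤s (s≤s s≤i))) j<u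
Adj⇒live s≤i s≤j i<u j<u (inj₂ refl) = ℕ.≤-trans (s≤s (s≤s (s≤s s≤j))) i<u

neighbour : ∀ {i π} → Occupied i π → ∃ λ j → Adj i j × Occupied j π
neighbour {i} {piece s u _} ((s≤i , i<u) , live) with suc (suc i) ℕ.<? u
... | yes 2+i<u = suc i , inj₁ refl , (ℕ.m≤n⇒m≤1+n s≤i , 2+i<u) , live
... | no  2+i≮u with i | ℕ.s≤s⁻¹ (ℕ.s≤s⁻¹ (ℕ.≤-trans live (ℕ.≮⇒≥ 2+i≮u)))
...   | suc j | s≤s s≤j = j , inj₂ refl , (s≤j , ℕ.<-trans (ℕ.n<1+n _) i<u) , live

neighbour-any : ∀ {i ps} → Any (Occupied i) ps → ∃ λ j → Adj i j × Any (Occupied j) ps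
neighbour-any {ps = π ∷ _} (here occ) = let j , adj , occ′ = neighbour {π = π} occ in j , adj , here occ′
neighbour-any {ps = _ ∷ _} (there occs) = let j , adj , occs′ = neighbour-any occs in j , adj , there occs′

occupied<n : ∀ {n i ps} → All (λ π → stop π ℕ.≤ suc n) ps → Any (Occupied i) ps → i ℕ.< n
occupied<n (u≤ ∷ _) (here ((_ , i<u) , _)) = ℕ.s≤s⁻¹ (ℕ.≤-trans i<u u≤)
occupied<n (_ ∷ us) (there occs)           = occupied<n us occs

module _ (a : ℤ) {n : ℕ} where

  private
    variable
      v : Subset n
      x : Fin n
      p : Bool

  -- The pieces may include dead ones, which occupy no vertex of v.
  record Represents (p : Bool) (v : Subset n) (ps : List Piece) : Set where
    field
      matches : All (λ π → Matches a p (start π) (stop π) (comp π)) ps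
      bounded : All (λ π → stop π ℕ.≤ suc n) ps
      apart   : AllPairs Apart ps
      covers  : ∀ {x} → x ∈ v → Any (Occupied (toℕ x)) ps
      covered : ∀ {x} → Any (Occupied (toℕ x)) ps → x ∈ v

    vertex : ∀ {i} → Any (Occupied i) ps → ∃ λ x → toℕ x ≡ i × x ∈ v
    vertex occ = fromℕ< i<n , toℕ-fromℕ< i<n ,
      covered (subst (λ j → Any (Occupied j) ps) (sym (toℕ-fromℕ< i<n)) occ)
      where
      i<n = occupied<n bounded occ

  open Represents

  Represents-resp-↭ : ∀ {ps qs} → ps ↭ qs → Represents p v ps → Represents p v qs
  Represents-resp-↭ σ rep = record
    { matches = All-resp-↭ σ (matches rep)
    ; bounded = All-resp-↭ σ (bounded rep)
    ; apart   = AllPairs-resp-↭ {_~_ = Apart} (λ far i j ini inj → Far-sym (far j i inj ini)) σ (apart rep)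
    ; covers  = Any-resp-↭ σ ∘ covers rep
    ; covered = covered rep ∘ Any-resp-↭ (↭-sym σ)
    }

  empty⇒dead : ∀ {ps} → Represents p v ps → Empty v → All Dead (comps ps)
  empty⇒dead {ps = ps} rep empty = All.map⁺ (All.tabulate dead)
    where
    dead : ∀ {π} → π ∈ₗ ps → Dead (comp π)
    dead π∈ with dead⊎live a (All.lookup (matches rep) π∈)
    ... | inj₁ D    = D
    ... | inj₂ live = contradiction
      (let x , _ , x∈v = vertex rep (lose π∈ ((ℕ.≤-refl , ℕ.<⇒≤ live) , live))
       in x , x∈v) empty

  dead⇒empty : ∀ {ps} → Represents p v ps → All Dead (comps ps) → Empty v
  dead⇒empty rep D (x , x∈v) with π , π∈ , (_ , live) ← find (covers rep x∈v) =
    ℕ.<⇒≱ live (dead⇒short a (All.lookup (All.map⁻ D) π∈) (All.lookup (matches rep) π∈))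

  -- The mover `q` and the viewpoint `p` are independent, so the same lemma serves the moves of both
  -- players. Forced vertices require no separate treatment: they are the single-vertex pieces,
  -- which occupy nothing.
  Represents-move : ∀ {s u c d e ps} q → Represents p v (piece s u c ∷ ps) →
    Occupied (toℕ x) (piece s u c) → owned a q x → Cut a p s (toℕ x) u d e →
    Represents p (move a q v x) (piece s (toℕ x) d ∷ piece (2 + toℕ x) u e ∷ ps)
  Represents-move {p} {v} {x} {s} {u} {c} {d} {e} {ps} q rep ((s≤x , x<u) , live) o (m₁ , m₂)
    with _ ∷ ms ← matches rep | u≤ ∷ us ← bounded rep | π# ∷ ps# ← apart rep = record
    { matches = m₁ ∷ m₂ ∷ ms
    ; bounded = ℕ.m≤n⇒m≤1+n (ℕ.<⇒≤ (toℕ<n x)) ∷ u≤ ∷ us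
    ; apart   = ((λ _ _ (_ , i<x) (x<j , _) → inj₁ (ℕ.≤-trans i<x (ℕ.≤-trans (ℕ.n≤1+n _) (ℕ.<⇒≤ x<j))))
                ∷ All.map (λ far _ j (s≤i , i<x) → far _ j (s≤i , ℕ.<-trans i<x x<u′)) π#)
                ∷ All.map (λ far _ j (x<i , i<u) → far _ j (ℕ.≤-trans s≤x (ℕ.<⇒≤ (ℕ.<⇒≤ x<i)) , i<u)) π#
                ∷ ps#
    ; covers  = covers′
    ; covered = covered′
    }
    where
    x<u′ : toℕ x ℕ.< u
    x<u′ = ℕ.<-trans (ℕ.n<1+n _) x<u
    x∈v : x ∈ v
    x∈v = covered rep (here ((s≤x , x<u) , live))
    new : List Piece
    new = piece s (toℕ x) d ∷ piece (2 + toℕ x) u e ∷ ps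

    -- A surviving vertex comes with a surviving neighbour, and adjacent survivors lie in the same
    -- piece and on the same side of `x`. Hence the new piece containing them has at least two
    -- vertices.
    covers′ : ∀ {y} → y ∈ move a q v x → Any (Occupied (toℕ y)) new
    covers′ y∈ with (y∈v , x#y) , z , (z∈v , x#z) , adj ← move⁻ a q x∈v o y∈
      with covers rep y∈v | covers rep z∈v
    ... | there occ | _ = there (there occ)
    ... | here (iny , _) | there occ with ρ , ρ∈ , (inz , _) ← find occ =
      contradiction adj (Far⇒¬Adj (All.lookup (AllPairs-head (apart rep)) ρ∈ _ _ iny inz))
      where
      AllPairs-head : ∀ {π ps} → AllPairs Apart (π ∷ ps) → All (Apart π) ps
      AllPairs-head (r ∷ _) = r
    ... | here ((s≤y , y<u) , _) | here ((s≤z , z<u) , _) with x#y | x#z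
    ...   | inj₁ x<y | inj₁ x<z = there (here ((x<y , y<u) , Adj⇒live x<y x<z y<u z<u adj))
    ...   | inj₂ y<x | inj₂ z<x = here ((s≤y , y<x) , Adj⇒live s≤y s≤z y<x z<x adj)
    ...   | inj₁ x<y | inj₂ z<x =
      contradiction adj (Far⇒¬Adj (inj₂ (ℕ.<-trans z<x (ℕ.<-trans (ℕ.n<1+n _) x<y))))
    ...   | inj₂ y<x | inj₁ x<z =
      contradiction adj (Far⇒¬Adj (inj₁ (ℕ.<-trans y<x (ℕ.<-trans (ℕ.n<1+n _) x<z))))

    old : ∀ {i} → Any (Occupied i) new → Any (Occupied i) (piece s u c ∷ ps) × Far (toℕ x) i
    old (here ((s≤i , i<x) , _)) = here ((s≤i , ℕ.<-trans i<x x<u′) , live) , inj₂ i<x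
    old (there (here ((x<i , i<u) , _))) =
      here ((ℕ.≤-trans s≤x (ℕ.<⇒≤ (ℕ.<⇒≤ x<i)) , i<u) , live) , inj₁ x<i
    old (there (there occ)) with ρ , ρ∈ , (ini , _) ← find occ | π# ∷ _ ← apart rep =
      there occ , All.lookup π# ρ∈ _ _ (s≤x , x<u) ini

    covered′ : ∀ {y} → Any (Occupied (toℕ y)) new → y ∈ move a q v x
    covered′ occ with j , adj , occ′ ← neighbour-any occ
      with occ₀ , x#y ← old occ | occ₀′ , x#z ← old occ′
      with z , refl , z∈v ← vertex rep occ₀′ =
      move⁺ a q (covered rep occ₀ , x#y) (z∈v , x#z) adj

  card-piece : ∀ {π} → Matches a p (start π) (stop π) (comp π) → stop π ℕ.≤ suc n →
               (q : Subset n) → (∀ {x} → x ∈ q → Occupied (toℕ x) π) →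
               (∀ {x} → Occupied (toℕ x) π → x ∈ q) → card q ≡ len (comp π)
  card-piece {π = piece s u c} m u≤ q out into with dead⊎live a m
  ... | inj₁ D    = ≡.trans
    (Empty⇒card≡0 λ (_ , x∈) → ℕ.<⇒≱ (proj₂ (out x∈)) (dead⇒short a D m)) (sym (len-dead D))
    where
    len-dead : ∀ {c} → Dead c → len c ≡ 0
    len-dead P₀ = refl
    len-dead P₁ = refl
    len-dead M₀ = refl
    len-dead M₁ = refl
    len-dead E₀ = refl
  ... | inj₂ live = ≡.trans
    (card-interval q s u u≤ (proj₁ ∘ out) (λ s≤ <u → into ((s≤ , <u) , live))) (length m)
    where
    odd : ∀ s k → s + (suc (suc k) + suc (suc k)) ≡ suc s + (3 + (k + k))
    odd = solve-∀ₙ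
    length : ∀ {c} → Matches a p s u c → u ∸ suc s ≡ len c
    length m@(isP {0} _ _) = contradiction (dead⇒short a P₀ m) (ℕ.<⇒≱ live)
    length m@(isP {1} _ _) = contradiction (dead⇒short a P₁ m) (ℕ.<⇒≱ live)
    length (isP {suc (suc k)} refl _) = ≡.trans (cong (_∸ suc s) (odd s k)) (ℕ.m+n∸m≡n (suc s) _)
    length m@(isM {0} _ _) = contradiction (dead⇒short a M₀ m) (ℕ.<⇒≱ live)
    length m@(isM {1} _ _) = contradiction (dead⇒short a M₁ m) (ℕ.<⇒≱ live)
    length (isM {suc (suc k)} refl _) = ≡.trans (cong (_∸ suc s) (odd s k)) (ℕ.m+n∸m≡n (suc s) _)
    length (isE {k} refl) = ℕ.m+n∸m≡n (suc s) (k + k)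

  card-Represents : ∀ {ps} → Represents p v ps → + card v ≡ ∑ (+_ ∘ len) (comps ps)
  card-Represents {ps = []} rep = cong +_ (Empty⇒card≡0 λ (_ , x∈v) → contradiction (covers rep x∈v) λ ())
  card-Represents {p} {v} {ps = π ∷ ps} rep
    with m ∷ ms ← matches rep | u≤ ∷ us ← bounded rep | π# ∷ ps# ← apart rep =
    ≡.trans (cong +_ (card-⊎ v q r split
               (covered rep ∘ here ∘ q⁻) (covered rep ∘ there ∘ r⁻) disjoint))
      (cong₂ ℤ._+_ (cong +_ (card-piece m u≤ q q⁻ (∈-comprehension⁺ q?)))
        (card-Represents {v = r} record
          { matches = ms ; bounded = us ; apart = ps# ; covers = r⁻ ; covered = ∈-comprehension⁺ r? }))
    where
    q? : (x : Fin n) → Dec (Occupied (toℕ x) π)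
    q? x = occupied? (toℕ x) π
    r? : (x : Fin n) → Dec (Any (Occupied (toℕ x)) ps)
    r? x = Any.any? (occupied? (toℕ x)) ps
    q r : Subset n
    q = comprehension q?
    r = comprehension r?
    q⁻ : ∀ {x} → x ∈ q → Occupied (toℕ x) π
    q⁻ = ∈-comprehension⁻ q?
    r⁻ : ∀ {x} → x ∈ r → Any (Occupied (toℕ x)) ps
    r⁻ = ∈-comprehension⁻ r?
    split : ∀ {x} → x ∈ v → x ∈ q ⊎ x ∈ r
    split x∈v with covers rep x∈v
    ... | here occ  = inj₁ (∈-comprehension⁺ q? occ)
    ... | there occ = inj₂ (∈-comprehension⁺ r? occ)
    disjoint : ∀ {x} → x ∈ q → x ∉ r
    disjoint x∈q x∈r with ρ , ρ∈ , (inx , _) ← find (r⁻ x∈r) | π# ∷ _ ← apart rep =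
      Far⇒≢ (All.lookup π# ρ∈ _ _ (proj₁ (q⁻ x∈q)) inx) refl

-- Scores as maxima and minima

maximum-attained : ∀ {A : Set} (f : A → ℤ) xs →
                   xs ≡ [] ⊎ ∃ λ x → x ∈ₗ xs × maximum (map f xs) ≡ f x
maximum-attained f []       = inj₁ refl
maximum-attained f (x ∷ xs) with argmax-sel id (f x) (map f xs)
... | inj₁ eq = inj₂ (x , here refl , eq)
... | inj₂ m∈ with y , y∈ , eq ← ∈-map⁻ f m∈ = inj₂ (y , there y∈ , eq)

minimum-attained : ∀ {A : Set} (f : A → ℤ) xs →
                   xs ≡ [] ⊎ ∃ λ x → x ∈ₗ xs × minimum (map f xs) ≡ f x
minimum-attained f []       = inj₁ refl
minimum-attained f (x ∷ xs) with argmin-sel id (f x) (map f xs)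
... | inj₁ eq = inj₂ (x , here refl , eq)
... | inj₂ m∈ with y , y∈ , eq ← ∈-map⁻ f m∈ = inj₂ (y , there y∈ , eq)

≤maximum : ∀ {A : Set} (f : A → ℤ) {x xs} → x ∈ₗ xs → f x ℤ.≤ maximum (map f xs)
≤maximum f {xs = y ∷ ys} (here refl) = ⊥≤max (f y) (map f ys)
≤maximum f {xs = y ∷ ys} (there x∈)  = All.lookup (xs≤max (f y) (map f ys)) (∈-map⁺ f x∈)

minimum≤ : ∀ {A : Set} (f : A → ℤ) {x xs} → x ∈ₗ xs → minimum (map f xs) ℤ.≤ f x
minimum≤ f {xs = y ∷ ys} (here refl) = min≤⊤ (f y) (map f ys)
minimum≤ f {xs = y ∷ ys} (there x∈)  = All.lookup (min≤xs (f y) (map f ys)) (∈-map⁺ f x∈)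

∈-elements⁺ : ∀ {n} {p : Subset n} {x} → x ∈ p → x ∈ₗ elements p
∈-elements⁺ {p = p} {x} = ∈-filter⁺ (_∈? p) (∈-allFin x)

∈-elements⁻ : ∀ {n} {p : Subset n} {x} → x ∈ₗ elements p → x ∈ p
∈-elements⁻ {p = p} x∈ = proj₂ (∈-filter⁻ (_∈? p) {xs = allFin _} x∈)

elements≡[]⇒Empty : ∀ {n} {p : Subset n} → elements p ≡ [] → Empty p
elements≡[]⇒Empty eq (x , x∈p) with () ← subst (x ∈ₗ_) eq (∈-elements⁺ x∈p)

x∈p⇒0<card : ∀ {n} {p : Subset n} {x} → x ∈ p → 0 ℕ.< card p
x∈p⇒0<card {p = true  ∷ p} _          = s≤s z≤n
x∈p⇒0<card {p = false ∷ p} (there x∈) = x∈p⇒0<card x∈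

-- The relative score is that of the starting player p, hence the sign of rs.
val : ∀ {n} → Bool → ℕ → Graph n → ℤ
val true  k G = ls k G
val false k G = - rs k G

after : ∀ {n} → Bool → ℕ → Graph n → Fin n → ℤ
after p k G x = + card (Rmv p G x) ℤ.- val (not p) k (G ∖ Rmv p G x)

neg-minus : ∀ i j → - (- i ℤ.+ j) ≡ i ℤ.- j
neg-minus = solve-∀

plus-minus : ∀ i j → i ℤ.+ j ≡ i ℤ.- (- j)
plus-minus = solve-∀

val-0 : ∀ {n} p (G : Graph n) → val p 0 G ≡ 0ℤ
val-0 true  G = refl
val-0 false G = refl

val-attained : ∀ {n} p k (G : Graph n) → (Empty (own p G) × val p (suc k) G ≡ 0ℤ) ⊎
               ∃ λ x → x ∈ own p G × val p (suc k) G ≡ after p k G x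
val-attained true k G
  with maximum-attained (λ x → + card (Rmvᴸ G x) ℤ.+ rs k (G ∖ Rmvᴸ G x)) (elements (L G))
... | inj₁ eq            = inj₁ (elements≡[]⇒Empty eq , cong (maximum ∘ map _) eq)
... | inj₂ (x , x∈ , eq) = inj₂ (x , ∈-elements⁻ x∈ , 
  ≡.trans eq (plus-minus (+ card (Rmvᴸ G x)) (rs k (G ∖ Rmvᴸ G x))))
val-attained false k G
  with minimum-attained (λ y → - (+ card (Rmvᴿ G y)) ℤ.+ ls k (G ∖ Rmvᴿ G y)) (elements (R G))
... | inj₁ eq            = inj₁ (elements≡[]⇒Empty eq , cong (-_ ∘ minimum ∘ map _) eq)
... | inj₂ (x , x∈ , eq) =
  inj₂ (x , ∈-elements⁻ x∈ , ≡.trans (cong -_ eq) (neg-minus (+ card (Rmvᴿ G x)) _))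

after≤val : ∀ {n} p k (G : Graph n) {x} → x ∈ own p G → after p k G x ℤ.≤ val p (suc k) G
after≤val true  k G {x} x∈ = ℤ.≤-trans
  (ℤ.≤-reflexive (sym (plus-minus (+ card (Rmvᴸ G x)) (rs k (G ∖ Rmvᴸ G x)))))
  (≤maximum (λ x → + card (Rmvᴸ G x) ℤ.+ rs k (G ∖ Rmvᴸ G x)) (∈-elements⁺ x∈))
after≤val false k G {x} x∈ = ℤ.≤-trans (ℤ.≤-reflexive (sym (neg-minus (+ card (Rmvᴿ G x)) _)))
  (ℤ.neg-mono-≤ (minimum≤ (λ y → - (+ card (Rmvᴿ G y)) ℤ.+ ls k (G ∖ Rmvᴿ G y)) (∈-elements⁺ x∈)))

Dead-neg : ∀ {c} → Dead c → Dead (neg c)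
Dead-neg P₀ = M₀
Dead-neg P₁ = M₁
Dead-neg M₀ = P₀
Dead-neg M₁ = P₁
Dead-neg E₀ = E₀

LMove-score : ∀ {c d e} → LMove c d e → score c ≡ 0ℤ
LMove-score (P→PP _ _ _) = refl
LMove-score (E→PE _ _ _) = refl
LMove-score (M→EE _ _ _) = refl

RMove-score : ∀ {c} d e → RMove c d e → score c ≡ 0ℤ
RMove-score {c} d e m = ≡.trans (sym (ℤ.neg-involutive (score c)))
  (cong -_ (≡.trans (sym (score-neg c)) (LMove-score m)))

-- From sums of paths to the game

module _ (a : ℤ) {n : ℕ} where

  private
    variable
      v : Subset n

  open Represents

  -- This is relevance of the position, since forced vertices are the isolated ones.
  Linked : Subset n → Set
  Linked v = ∀ {y} → y ∈ v → ∃ λ z → z ∈ v × Adj (toℕ y) (toℕ z)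

  Represents⇒Linked : ∀ {p ps} → Represents a p v ps → Linked v
  Represents⇒Linked rep y∈v with j , adj , occ ← neighbour-any (covers rep y∈v)
    with z , refl , z∈v ← vertex rep occ = z , z∈v , adj

  -- Neighbours have opposite owners, so on a linked board each player owns a vertex unless the
  -- board is empty. Thus the default value 0 of an empty maximum or minimum arises only when the
  -- game is over.
  own-empty⇒empty : ∀ p → Linked v → Empty (own p (board a v)) → Empty v
  own-empty⇒empty p linked empty (y , y∈v) with owner a (toℕ y) ≟ᵇ p
  ... | yes oy = empty (y , own⁺ a p y∈v oy)
  ... | no ¬oy with z , z∈v , adj ← linked y∈v =
    empty (z , own⁺ a p z∈v (≡.trans (Adj⇒owned a adj (¬-not ¬oy)) (not-involutive p)))

  move-decreasing : ∀ q {x k} → x ∈ v → card v ℕ.≤ suc k → card (move a q v x) ℕ.≤ k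
  move-decreasing {v} q {x} {k} x∈v v≤ = ℕ.s≤s⁻¹ (ℕ.≤-trans (begin-strict
    card (move a q v x)                                  <⟨ ℕ.m<n+m _ (x∈p⇒0<card x∈R) ⟩
    card (Rmv q (board a v) x) + card (move a q v x)     ≡⟨ card-─ (rmv⊆ a q x∈v) ⟨
    card v                                               ∎) v≤)
    where
    open ℕ.≤-Reasoning
    x∈R : x ∈ Rmv q (board a v) x
    x∈R = rmv⁺ a q (inj₁ (reach-self a q))

  -- The removed set is counted as the difference of the board before and after the move; the
  -- untouched pieces cancel.
  removed : ∀ {p π ρ σ ps x} q {g} → x ∈ v → Represents a p v (π ∷ ps) →
            Represents a p (move a q v x) (ρ ∷ σ ∷ ps) →
            + len (comp π) ≡ g ℤ.+ (+ len (comp ρ) ℤ.+ + len (comp σ)) →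
            + card (Rmv q (board a v) x) ≡ g
  removed {v} {π = π} {ρ} {σ} {ps} {x} q {g} x∈v rep rep′ gain = begin
    + r                                         ≡⟨ minus (+ r) (+ r′) ⟩
    + r ℤ.+ + r′ ℤ.- + r′                       ≡⟨ cong₂ ℤ._-_ remaining (card-Represents a rep′) ⟩
    + len (comp π) ℤ.+ S ℤ.- (l ℤ.+ (m ℤ.+ S))  ≡⟨ cong (λ i → i ℤ.+ S ℤ.- (l ℤ.+ (m ℤ.+ S))) gain ⟩
    g ℤ.+ (l ℤ.+ m) ℤ.+ S ℤ.- (l ℤ.+ (m ℤ.+ S)) ≡⟨ cancel g l m S ⟩
    g                                           ∎
    where
    open ≡.≡-Reasoning
    r r′ : ℕ
    r  = card (Rmv q (board a v) x)
    r′ = card (move a q v x)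
    l m S : ℤ
    l = + len (comp ρ)
    m = + len (comp σ)
    S = ∑ (+_ ∘ len) (comps ps)
    remaining : + r ℤ.+ + r′ ≡ + len (comp π) ℤ.+ S
    remaining = ≡.trans (cong +_ (sym (card-─ (rmv⊆ a q x∈v)))) (card-Represents a rep)
    minus : ∀ i j → i ≡ i ℤ.+ j ℤ.- j
    minus = solve-∀
    cancel : ∀ i j k l → i ℤ.+ (j ℤ.+ k) ℤ.+ l ℤ.- (j ℤ.+ (k ℤ.+ l)) ≡ i
    cancel = solve-∀

  Gain : Comp → Comp → Comp → Set
  Gain c d e = + len c ≡ + 3 ℤ.+ score d ℤ.+ score e ℤ.+ (+ len d ℤ.+ + len e)

  Loss : Comp → Comp → Comp → Set
  Loss c d e = + len c ≡ + 3 ℤ.- score d ℤ.- score e ℤ.+ (+ len d ℤ.+ + len e)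

  -- In the game the value of a degenerate piece is settled by the move that creates it, whereas the
  -- bound `w` counts it at the end of play. Adding `∑ score` of the present pieces reconciles the
  -- two. The player `p` takes the role of Left, so one statement covers both colours.
  val≤ : ∀ k p {ps w} → Represents a p v ps → card v ℕ.≤ k → comps ps ≤ᴸ w →
         val p k (board a v) ℤ.+ ∑ score (comps ps) ℤ.≤ w
  ≤val : ∀ k p {ps w} → Represents a p v ps → card v ℕ.≤ k → comps ps ≤ᴿ w →
         - val (not p) k (board a v) ℤ.+ ∑ score (comps ps) ℤ.≤ w

  val≤ {v} zero p {ps} rep v≤ (against dead _)
    rewrite val-0 p (board a v) | ℤ.+-identityˡ (∑ score (comps ps)) =
    dead (empty⇒dead a rep λ (_ , x∈v) → ℕ.<⇒≱ (x∈p⇒0<card x∈v) v≤)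
  val≤ {v} (suc k) p {ps} {w} rep v≤ (against dead moves) with val-attained p k (board a v)
  ... | inj₁ (empty , eq) rewrite eq | ℤ.+-identityˡ (∑ score (comps ps)) =
    dead (empty⇒dead a rep (own-empty⇒empty p (Represents⇒Linked rep) empty))
  ... | inj₂ (x , x∈ , eq)
    with x∈v , ox ← own⁻ a {v = v} p x∈
    with piece s u c , π∈ , occ@((s≤x , x<u) , live) ← find (covers rep x∈v)
    with rep′ ← Represents-resp-↭ a (∈⇒↭ π∈) rep
    with m ∷ _ ← matches rep′
    with d , e , m′ , lm ← cut a m live s≤x x<u ox = finish lm
    where
    rest : List Piece
    rest = ps ─ₗ π∈
    rep″ : Represents a p (move a p v x) (piece s (toℕ x) d ∷ piece (2 + toℕ x) u e ∷ rest)
    rep″ = Represents-move a p rep′ occ ox m′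

    regroup : ∀ v′ i j k → + 3 ℤ.+ i ℤ.+ j ℤ.- v′ ℤ.+ (0ℤ ℤ.+ k) ≡
                           (- v′ ℤ.+ (i ℤ.+ (j ℤ.+ k))) ℤ.+ + 3
    regroup = solve-∀
    cancel : ∀ i → i ℤ.- + 3 ℤ.+ + 3 ≡ i
    cancel = solve-∀

    conclude : score c ≡ 0ℤ → Gain c d e → d ∷ e ∷ comps rest ≤ᴿ w ℤ.- + 3 →
               val p (suc k) (board a v) ℤ.+ ∑ score (comps ps) ℤ.≤ w
    conclude score≡0 gain r = begin
      val p (suc k) (board a v) ℤ.+ ∑ score (comps ps)
        ≡⟨ cong₂ ℤ._+_ eq (∑-↭ score (map⁺ comp (∈⇒↭ π∈))) ⟩
      + card (Rmv p (board a v) x) ℤ.- v′ ℤ.+ (score c ℤ.+ S)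
        ≡⟨ cong₂ (λ i j → i ℤ.- v′ ℤ.+ (j ℤ.+ S))
             (removed p {+ 3 ℤ.+ score d ℤ.+ score e} x∈v rep′ rep″ gain) score≡0 ⟩
      + 3 ℤ.+ score d ℤ.+ score e ℤ.- v′ ℤ.+ (0ℤ ℤ.+ S)
        ≡⟨ regroup v′ (score d) (score e) S ⟩
      (- v′ ℤ.+ (score d ℤ.+ (score e ℤ.+ S))) ℤ.+ + 3
        ≤⟨ ℤ.+-monoˡ-≤ (+ 3) (≤val k p rep″ (move-decreasing p x∈v v≤) r) ⟩
      w ℤ.- + 3 ℤ.+ + 3
        ≡⟨ cancel w ⟩
      w ∎
      where
      open ℤ.≤-Reasoning
      v′ S : ℤ
      v′ = val (not p) k (board a (move a p v x))
      S  = ∑ score (comps rest)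

    swap-gain : ∀ i j k l → + 3 ℤ.+ i ℤ.+ j ℤ.+ (k ℤ.+ l) ≡ + 3 ℤ.+ j ℤ.+ i ℤ.+ (l ℤ.+ k)
    swap-gain = solve-∀

    finish : LMove c d e ⊎ LMove c e d → val p (suc k) (board a v) ℤ.+ ∑ score (comps ps) ℤ.≤ w
    finish (inj₁ lm) = conclude (LMove-score lm) (LMove-len lm) (moves (map⁺ comp (∈⇒↭ π∈)) lm)
    finish (inj₂ lm) = conclude (LMove-score lm)
      (≡.trans (LMove-len lm) (swap-gain (score e) (score d) (+ len e) (+ len d)))
      (≤ᴿ-resp-↭ (swap e d refl) (moves (map⁺ comp (∈⇒↭ π∈)) lm))

  ≤val {v} k p {ps} {w} rep v≤ (over D le) = subst (ℤ._≤ w)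
    (≡.trans (sym (ℤ.+-identityˡ _)) (cong (λ i → - i ℤ.+ ∑ score (comps ps)) (sym (val≡0 k)))) le
    where
    val≡0 : ∀ k → val (not p) k (board a v) ≡ 0ℤ
    val≡0 zero = val-0 (not p) (board a v)
    val≡0 (suc k) with val-attained (not p) k (board a v)
    ... | inj₁ (_ , eq)       = eq
    ... | inj₂ (x , x∈ , _) =
      contradiction (x , proj₁ (own⁻ a {v = v} (not p) x∈)) (dead⇒empty a rep D)
  ≤val {v} k p {ps} {w} rep v≤ (play {c} {d} {e} {Y} σ rm r)
    with piece s u _ ∷ rest , refl , σ′ ← ↭-map-inv comp σ
    with rep′ ← Represents-resp-↭ a σ′ rep
    with m ∷ _ ← matches rep′
    with dead⊎live a m
  ... | inj₁ D    = contradiction rm (Dead⇒¬LMove (Dead-neg D))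
  ... | inj₂ live with x , s≤x , x<u , ox , m′ ← uncut-opponent a {d = d} {e} m rm
    with x , refl , x∈v ← vertex rep′ (here ((s≤x , x<u) , live)) = played k v≤ m′
    where
    open ℤ.≤-Reasoning
    S : ℤ
    S = ∑ score (comps rest)

    regroup : ∀ v′ i j k → - (+ 3 ℤ.- i ℤ.- j ℤ.- v′) ℤ.+ (0ℤ ℤ.+ k) ≡
                           (v′ ℤ.+ (i ℤ.+ (j ℤ.+ k))) ℤ.- + 3
    regroup = solve-∀
    cancel : ∀ i → i ℤ.+ + 3 ℤ.- + 3 ≡ i
    cancel = solve-∀
    swap-loss : ∀ i j k l → + 3 ℤ.- i ℤ.- j ℤ.+ (k ℤ.+ l) ≡ + 3 ℤ.- j ℤ.- i ℤ.+ (l ℤ.+ k)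
    swap-loss = solve-∀

    conclude : ∀ k d e → card v ℕ.≤ suc k → Cut a p s (toℕ x) u d e → Loss c d e →
               d ∷ e ∷ comps rest ≤ᴸ w ℤ.+ + 3 →
               - val (not p) (suc k) (board a v) ℤ.+ ∑ score (comps ps) ℤ.≤ w
    conclude k d e v≤ m′ loss r = begin
      - val (not p) (suc k) (board a v) ℤ.+ ∑ score (comps ps)
        ≤⟨ ℤ.+-mono-≤ (ℤ.neg-mono-≤ (after≤val (not p) k (board a v) (own⁺ a (not p) x∈v ox)))
                       (ℤ.≤-reflexive (∑-↭ score (map⁺ comp σ′))) ⟩
      - (+ card (Rmv (not p) (board a v) x) ℤ.- val (not (not p)) k G′) ℤ.+ (score c ℤ.+ S)
        ≡⟨ cong (λ q → - (+ card (Rmv (not p) (board a v) x) ℤ.- val q k G′) ℤ.+ (score c ℤ.+ S))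
                (not-involutive p) ⟩
      - (+ card (Rmv (not p) (board a v) x) ℤ.- v′) ℤ.+ (score c ℤ.+ S)
        ≡⟨ cong₂ (λ i j → - (i ℤ.- v′) ℤ.+ (j ℤ.+ S))
             (removed (not p) {+ 3 ℤ.- score d ℤ.- score e} x∈v rep′ rep″ loss)
             (RMove-score _ _ rm) ⟩
      - (+ 3 ℤ.- score d ℤ.- score e ℤ.- v′) ℤ.+ (0ℤ ℤ.+ S)
        ≡⟨ regroup v′ (score d) (score e) S ⟩
      (v′ ℤ.+ (score d ℤ.+ (score e ℤ.+ S))) ℤ.- + 3
        ≤⟨ ℤ.+-monoˡ-≤ (- + 3) (val≤ k p rep″ (move-decreasing (not p) x∈v v≤) r) ⟩
      w ℤ.+ + 3 ℤ.- + 3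
        ≡⟨ cancel w ⟩
      w ∎
      where
      G′ : Graph n
      G′ = board a (move a (not p) v x)
      v′ : ℤ
      v′ = val p k G′
      rep″ : Represents a p (move a (not p) v x) (piece s (toℕ x) d ∷ piece (2 + toℕ x) u e ∷ rest)
      rep″ = Represents-move a (not p) rep′ ((s≤x , x<u) , live) ox m′

    played : ∀ k → card v ℕ.≤ k → Cut a p s (toℕ x) u d e ⊎ Cut a p s (toℕ x) u e d →
             - val (not p) k (board a v) ℤ.+ ∑ score (comps ps) ℤ.≤ w
    played zero    v≤ _         = contradiction v≤ (ℕ.<⇒≱ (x∈p⇒0<card x∈v))
    played (suc k) v≤ (inj₁ m′) = conclude k d e v≤ m′ (RMove-len d e rm) r
    played (suc k) v≤ (inj₂ m′) = conclude k e d v≤ m′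
      (≡.trans (RMove-len d e rm) (swap-loss (score d) (score e) (+ len d) (+ len e)))
      (≤ᴸ-resp-↭ (swap d e refl) r)

-- Parity of the score

module _ (a : ℤ) {n : ℕ} where

  private
    variable
      v : Subset n

  -- Modulo 2 the signs of the two players' gains do not matter, so the score is congruent to the
  -- number of vertices removed in all, which is the whole board.
  val-parity : ∀ k p → card v ℕ.≤ k → Linked a v →
               ∃ λ z → val p k (board a v) ≡ + card v ℤ.+ (z ℤ.+ z)
  val-parity {v} zero p v≤ _ = 0ℤ , ≡.trans (val-0 p (board a v))
    (cong (λ m → + m ℤ.+ 0ℤ) (sym (ℕ.n≤0⇒n≡0 v≤)))
  val-parity {v} (suc k) p v≤ linked with val-attained p k (board a v)
  ... | inj₁ (empty , eq) = 0ℤ , ≡.trans eq (cong (λ m → + m ℤ.+ 0ℤ) (sym (Empty⇒card≡0 (own-empty⇒empty a p linked empty))))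
  ... | inj₂ (x , x∈ , eq)
    with x∈v , ox ← own⁻ a {v = v} p x∈
    with z , eq′ ← val-parity {v = move a p v x} k (not p) (move-decreasing a p x∈v v≤)
           (λ y∈ → let sy , w , sw , adj = move⁻ a p x∈v ox y∈
                   in w , move⁺ a p sw sy (Adj-sym adj) , adj) =
    - (+ r′ ℤ.+ z) , (begin
      val p (suc k) (board a v)                                  ≡⟨ eq ⟩
      + r ℤ.- val (not p) k (board a (move a p v x))             ≡⟨ cong (ℤ._-_ (+ r)) eq′ ⟩
      + r ℤ.- (+ r′ ℤ.+ (z ℤ.+ z))                               ≡⟨ regroup (+ r) (+ r′) z ⟩
      (+ r ℤ.+ + r′) ℤ.+ (- (+ r′ ℤ.+ z) ℤ.+ - (+ r′ ℤ.+ z))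
        ≡⟨ cong (λ m → + m ℤ.+ (- (+ r′ ℤ.+ z) ℤ.+ - (+ r′ ℤ.+ z))) (card-─ (rmv⊆ a p x∈v)) ⟨
      + card v ℤ.+ (- (+ r′ ℤ.+ z) ℤ.+ - (+ r′ ℤ.+ z))           ∎)
    where
    open ≡.≡-Reasoning
    r r′ : ℕ
    r  = card (Rmv p (board a v) x)
    r′ = card (move a p v x)
    regroup : ∀ i j k → i ℤ.- (j ℤ.+ (k ℤ.+ k)) ≡ (i ℤ.+ j) ℤ.+ (- (j ℤ.+ k) ℤ.+ - (j ℤ.+ k))
    regroup = solve-∀

  module _ (2≤n : 2 ℕ.≤ n) where

    start-Represents : ∀ {p c} → Matches a p 0 (suc n) c → Represents a p ⊤ (piece 0 (suc n) c ∷ [])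
    start-Represents m = record
      { matches = m ∷ []
      ; bounded = ℕ.≤-refl ∷ []
      ; apart   = [] ∷ []
      ; covers  = λ {x} _ → here ((z≤n , s≤s (toℕ<n x)) , s≤s 2≤n)
      ; covered = λ _ → ∈⊤
      }

    value : Bool → ℤ
    value p = val p (card (⊤ {n})) (segment a n)

    value≤ : ∀ {p c w} → Matches a p 0 (suc n) c → score c ≡ 0ℤ → [ c ] ≤ᴸ w → value p ℤ.≤ w
    value≤ {p} {c} m eq l = subst (ℤ._≤ _)
      (≡.trans (cong (λ i → value p ℤ.+ (i ℤ.+ 0ℤ)) eq) (ℤ.+-identityʳ (value p)))
      (val≤ a (card (⊤ {n})) p (start-Represents m) ℕ.≤-refl l)

    ≤value : ∀ {p c w} → Matches a (not p) 0 (suc n) c → score c ≡ 0ℤ → [ c ] ≤ᴿ w → - w ℤ.≤ value p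
    ≤value {p} {c} {w} m eq r = subst (- w ℤ.≤_) (ℤ.neg-involutive (value p)) (ℤ.neg-mono-≤
      (subst (ℤ._≤ w)
        (≡.trans (cong₂ (λ q i → - value q ℤ.+ (i ℤ.+ 0ℤ)) (not-involutive p) eq)
                 (ℤ.+-identityʳ (- value p)))
        (≤val a (card (⊤ {n})) (not p) (start-Represents m) ℕ.≤-refl r)))

    value-parity : ∀ p → ∃ λ z → value p ≡ + n ℤ.+ (z ℤ.+ z)
    value-parity p = subst (λ m → ∃ λ z → value p ≡ + m ℤ.+ (z ℤ.+ z)) (∣⊤∣≡n n)
      (val-parity (card (⊤ {n})) p ℕ.≤-refl linked)
      where
      linked : Linked a ⊤
      linked {y} _
        with j , adj , ((_ , j<n) , _) ← neighbour {π = piece 0 (suc n) (E 0)}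
                                           ((z≤n , s≤s (toℕ<n y)) , s≤s 2≤n) =
        fromℕ< (ℕ.s≤s⁻¹ j<n) , ∈⊤ , subst (Adj (toℕ y)) (sym (toℕ-fromℕ< (ℕ.s≤s⁻¹ j<n))) adj

-- Values allowed by bounds and parity

even-window : ∀ i j → + 2 ℤ.≤ i → i ℤ.≤ + 4 → i ≡ j ℤ.+ j → i ≡ + 2 ⊎ i ≡ + 4
even-window _ (+ 1) _ _ refl = inj₁ refl
even-window _ (+ 2) _ _ refl = inj₂ refl
even-window _ (+ 0) (ℤ.+≤+ ()) _ refl
even-window _ (+ suc (suc (suc m))) _ (ℤ.+≤+ le) refl =
  contradiction le (ℕ.<⇒≱ (s≤s (s≤s (s≤s (ℕ.m≤n⇒m≤o+n m (s≤s (s≤s z≤n)))))))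
even-window _ -[1+ _ ] () _ refl

odd-window : ∀ i j → 0ℤ ℤ.≤ i → i ℤ.≤ + 5 → i ≡ 1ℤ ℤ.+ (j ℤ.+ j) → i ≡ + 1 ⊎ i ≡ + 3 ⊎ i ≡ + 5
odd-window _ (+ 0) _ _ refl = inj₁ refl
odd-window _ (+ 1) _ _ refl = inj₂ (inj₁ refl)
odd-window _ (+ 2) _ _ refl = inj₂ (inj₂ refl)
odd-window _ (+ suc (suc (suc m))) _ (ℤ.+≤+ le) refl =
  contradiction le (ℕ.<⇒≱ (s≤s (s≤s (s≤s (s≤s (ℕ.m≤n⇒m≤o+n m (s≤s (s≤s z≤n))))))))
odd-window _ -[1+ _ ] () _ refl

odd-window-≤4 : ∀ i j → 0ℤ ℤ.≤ i → i ℤ.≤ + 4 → i ≡ 1ℤ ℤ.+ (j ℤ.+ j) → i ≡ + 1 ⊎ i ≡ + 3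
odd-window-≤4 i j lo hi eq with odd-window i j lo (ℤ.≤-trans hi (ℤ.+≤+ (ℕ.n≤1+n 4))) eq
... | inj₁ i≡1         = inj₁ i≡1
... | inj₂ (inj₁ i≡3)  = inj₂ i≡3
... | inj₂ (inj₂ refl) with ℤ.+≤+ (s≤s (s≤s (s≤s (s≤s ())))) ← hi

odd-window-3 : ∀ i j → + 3 ℤ.≤ i → i ℤ.≤ + 4 → i ≡ 1ℤ ℤ.+ (j ℤ.+ j) → i ≡ + 3
odd-window-3 i j lo hi eq with odd-window-≤4 i j (ℤ.≤-trans (ℤ.+≤+ z≤n) lo) hi eq
... | inj₂ i≡3  = i≡3
... | inj₁ refl with ℤ.+≤+ (s≤s ()) ← lo

-- Both colours of the first vertex are treated at once, because dropping it exchanges the two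
-- cases.
card-alternating : ∀ (a : ℤ) {n} (v : Subset n) s p →
  (∀ {x} → x ∈ v → owner a (s + toℕ x) ≡ p) → (∀ {x} → owner a (s + toℕ x) ≡ p → x ∈ v) →
  (owner a s ≡ p → card v ≡ ⌈ n /2⌉) × (owner a s ≡ not p → card v ≡ ⌊ n /2⌋)
card-alternating a [] s p out into = (λ _ → refl) , (λ _ → refl)
card-alternating a {suc n} (b ∷ v) s p out into
  with atp , atq ← card-alternating a v (suc s) p
         (λ {x} x∈ → ≡.trans (cong (owner a) (sym (ℕ.+-suc s (toℕ x)))) (out (there x∈)))
         (λ {x} o → drop-there (into (≡.trans (cong (owner a) (ℕ.+-suc s (toℕ x))) o))) = heads b out into
  where
  at0 : owner a (s + 0) ≡ owner a s
  at0 = cong (owner a) (ℕ.+-identityʳ s)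

  heads : ∀ b → (∀ {x} → x ∈ b ∷ v → owner a (s + toℕ x) ≡ p) →
          (∀ {x} → owner a (s + toℕ x) ≡ p → x ∈ b ∷ v) →
          (owner a s ≡ p → card (b ∷ v) ≡ ⌈ suc n /2⌉) ×
          (owner a s ≡ not p → card (b ∷ v) ≡ ⌊ suc n /2⌋)
  heads true out _ =
    (λ o → cong suc (atq (≡.trans (owner-suc a s) (cong not o)))) ,
    (λ o → contradiction (≡.trans (sym o) (≡.trans (sym at0) (out here))) (not-¬ refl ∘ sym))
  heads false _ into =
    (λ o → contradiction (into {zero} (≡.trans at0 o)) λ ()) ,
    (λ o → atp (≡.trans (owner-suc a s) (≡.trans (cong not o) (not-involutive p))))

2∣k+k : ∀ k → 2 ∣ k + k
2∣k+k k = divides k (double k)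
  where
  double : ∀ k → k + k ≡ k ℕ.* 2
  double = solve-∀ₙ

2∤1+k+k : ∀ k → ¬ 2 ∣ suc (k + k)
2∤1+k+k k = 2∣n⇒2∤1+n (k + k) (2∣k+k k)

E-≤ᴿ : ∀ k → [ E (suc k) ] ≤ᴿ - + 2
E-≤ᴿ k with half k
... | i , inj₁ refl = E-odd-≤ᴿ i
... | i , inj₂ refl = E-even-≤ᴿ i

P-2∣-≤ᴿ : ∀ k → 2 ∣ k → [ P (2 + k) ] ≤ᴿ - + 3
P-2∣-≤ᴿ k 2∣k with half k
... | i , inj₁ refl = P-even-≤ᴿ i
... | i , inj₂ refl = contradiction 2∣k (2∤1+k+k i)

P-≤ᴿ : ∀ k → [ P (2 + k) ] ≤ᴿ -1ℤ
P-≤ᴿ k with half k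
... | i , inj₁ refl = ≤ᴿ-mono (ℤ.-≤- z≤n) (P-even-≤ᴿ i)
... | i , inj₂ refl = P-odd-≤ᴿ i

even-segment : ∀ a {n} k → n ≡ k + k → (2≤n : 2 ℕ.≤ n) → ∀ p →
               value a 2≤n p ≡ + 2 ⊎ value a 2≤n p ≡ + 4
even-segment a zero    refl ()
even-segment a {n} (suc k) len 2≤n p = even-window _ (+ suc k ℤ.+ proj₁ parity)
  (≤value a 2≤n {p} isE′ refl (E-≤ᴿ k))
  (value≤ a 2≤n {p} isE′ refl (single-≤ᴸ (E (suc k))))
  (≡.trans (proj₂ parity)
    (≡.trans (cong (λ m → + m ℤ.+ (z ℤ.+ z)) len) (regroup (+ suc k) z)))
  where
  isE′ : ∀ {q} → Matches a q 0 (suc n) (E (suc k))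
  isE′ = isE (cong suc (sym len))
  parity : ∃ λ z → value a 2≤n p ≡ + n ℤ.+ (z ℤ.+ z)
  parity = value-parity a 2≤n p
  z : ℤ
  z = proj₁ parity
  regroup : ∀ i j → i ℤ.+ i ℤ.+ (j ℤ.+ j) ≡ (i ℤ.+ j) ℤ.+ (i ℤ.+ j)
  regroup = solve-∀

module _ (a : ℤ) {n : ℕ} (k : ℕ) (length : n ≡ suc (suc k + suc k)) (2≤n : 2 ℕ.≤ n)
         (q : Bool) (o : owner a 0 ≡ q) where

  private
    isP′ : Matches a q 0 (suc n) (P (2 + k))
    isP′ = isP (≡.trans (span k) (cong suc (sym length))) o
      where
      span : ∀ k → suc (suc k) + suc (suc k) ≡ suc (suc (suc k + suc k))
      span = solve-∀ₙ

    isM′ : Matches a (not q) 0 (suc n) (M (2 + k))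
    isM′ = Matches-neg a isP′

    half-value : Bool → ℤ
    half-value p = + suc k ℤ.+ proj₁ (value-parity a 2≤n p)

    parity : ∀ p → value a 2≤n p ≡ 1ℤ ℤ.+ (half-value p ℤ.+ half-value p)
    parity p = ≡.trans (proj₂ (value-parity a 2≤n p))
      (≡.trans (cong (λ m → + m ℤ.+ (z ℤ.+ z)) length) (regroup (+ suc k) z))
      where
      z : ℤ
      z = proj₁ (value-parity a 2≤n p)
      regroup : ∀ i j → 1ℤ ℤ.+ (i ℤ.+ i) ℤ.+ (j ℤ.+ j) ≡ 1ℤ ℤ.+ ((i ℤ.+ j) ℤ.+ (i ℤ.+ j))
      regroup = solve-∀

    opponent≤4 : value a 2≤n (not q) ℤ.≤ + 4
    opponent≤4 = value≤ a 2≤n isM′ refl (single-≤ᴸ (M (2 + k)))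

    ≤opponent : ∀ {w} → [ P (2 + k) ] ≤ᴿ w → - w ℤ.≤ value a 2≤n (not q)
    ≤opponent = ≤value a 2≤n
      (subst (λ p → Matches a p 0 (suc n) (P (2 + k))) (sym (not-involutive q)) isP′) refl

  -- The opponent's hottest-path strategy caps the score at 5, and the owner's own, seen on the
  -- negated path `M (2 + k)` of weight 0, guarantees 0. Only three odd values remain.
  odd-segment-owner : value a 2≤n q ≡ + 1 ⊎ value a 2≤n q ≡ + 3 ⊎ value a 2≤n q ≡ + 5
  odd-segment-owner = odd-window _ (half-value q)
    (≤value a 2≤n isM′ refl (single-≤ᴿ (M (2 + k))))
    (value≤ a 2≤n isP′ refl (single-≤ᴸ (P (2 + k))))
    (parity q)

  odd-segment-opponent : value a 2≤n (not q) ≡ + 1 ⊎ value a 2≤n (not q) ≡ + 3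
  odd-segment-opponent = odd-window-≤4 _ (half-value (not q))
    (ℤ.≤-trans (ℤ.+≤+ z≤n) (≤opponent (P-≤ᴿ k))) opponent≤4 (parity (not q))

  -- For even `k` the middle vertex, at offset `k + 1`, belongs to the opponent of the ends; playing
  -- it leaves two equal even halves that cancel, so the full 3 points are kept.
  odd-segment-opponent-3 : 2 ∣ k → value a 2≤n (not q) ≡ + 3
  odd-segment-opponent-3 2∣k = odd-window-3 _ (half-value (not q))
    (≤opponent (P-2∣-≤ᴿ k 2∣k)) opponent≤4 (parity (not q))

-- Recognising the classes of segments

card-own : ∀ a n p → (owner a 0 ≡ p → card (own p (segment a n)) ≡ ⌈ n /2⌉) ×
                     (owner a 0 ≡ not p → card (own p (segment a n)) ≡ ⌊ n /2⌋)
card-own a n p = card-alternating a (own p (segment a n)) 0 p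
  (λ x∈ → proj₂ (own⁻ a {v = ⊤} p x∈)) (own⁺ a {v = ⊤} p ∈⊤)

neg-≡ : ∀ {i j} → - i ≡ j → i ≡ - j
neg-≡ {i} refl = sym (ℤ.neg-involutive i)

⌈1+k+k/2⌉ : ∀ k → ⌈ suc (k + k) /2⌉ ≡ suc k
⌈1+k+k/2⌉ k = cong suc (sym (ℕ.n≡⌊n+n/2⌋ k))

⌊1+k+k/2⌋ : ∀ k → ⌊ suc (k + k) /2⌋ ≡ k
⌊1+k+k/2⌋ k = sym (ℕ.n≡⌈n+n/2⌉ k)

C₌⇒even : ∀ a n → C₌ (segment a n) → ∃ λ k → n ≡ k + k
C₌⇒even a n even with half n
... | k , inj₁ len = k , len
... | k , inj₂ len =
  contradiction (subst (2 ∣_) (≡.trans (∣⊤∣≡n n) len) even) (2∤1+k+k k)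

odd-length : ∀ n → 2 ℕ.≤ n → ¬ 2 ∣ card (⊤ {n}) → ∃ λ k → n ≡ suc (suc k + suc k)
odd-length n 2≤n odd with half n
... | k     , inj₁ len = contradiction
  (subst (2 ∣_) (≡.trans (sym len) (sym (∣⊤∣≡n n))) (2∣k+k k)) odd
... | suc k , inj₂ len = k , len
... | zero  , inj₂ len with s≤s () ← subst (2 ℕ.≤_) len 2≤n

module _ (a : ℤ) (n k : ℕ) (length : n ≡ suc (suc k + suc k)) where

  card-owner : ∀ p → owner a 0 ≡ p → card (own p (segment a n)) ≡ suc (suc k)
  card-owner p o = ≡.trans (proj₁ (card-own a n p) o)
    (≡.trans (cong ⌈_/2⌉ length) (⌈1+k+k/2⌉ (suc k)))

  card-opponent : ∀ p → owner a 0 ≡ not p → card (own p (segment a n)) ≡ suc k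
  card-opponent p o = ≡.trans (proj₂ (card-own a n p) o)
    (≡.trans (cong ⌊_/2⌋ length) (⌊1+k+k/2⌋ (suc k)))

  imbalance : + card (own true (segment a n)) ℤ.- + card (own false (segment a n)) ≡
              (if owner a 0 then 1ℤ else -1ℤ)
  imbalance = by-owner (owner a 0) refl
    where
    plus-one : ∀ i → 1ℤ ℤ.+ i ℤ.- i ≡ 1ℤ
    plus-one = solve-∀
    minus-one : ∀ i → i ℤ.- (1ℤ ℤ.+ i) ≡ -1ℤ
    minus-one = solve-∀
    by-owner : ∀ q → owner a 0 ≡ q →
      + card (own true (segment a n)) ℤ.- + card (own false (segment a n)) ≡ (if q then 1ℤ else -1ℤ)
    by-owner true  o = ≡.trans
      (cong₂ (λ i j → + i ℤ.- + j) (card-owner true o) (card-opponent false o)) (plus-one (+ suc k))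
    by-owner false o = ≡.trans
      (cong₂ (λ i j → + i ℤ.- + j) (card-opponent true o) (card-owner false o)) (minus-one (+ suc k))

C₊⇒odd : ∀ a n → 2 ℕ.≤ n → C₊ (segment a n) →
         ∃ λ k → n ≡ suc (suc k + suc k) × owner a 0 ≡ true
C₊⇒odd a n 2≤n (odd , diff) = let k , len = odd-length n 2≤n odd in
  k , len , by-owner (owner a 0) (≡.trans (sym (imbalance a n k len)) diff)
  where
  by-owner : ∀ q → (if q then 1ℤ else -1ℤ) ≡ 1ℤ → q ≡ true
  by-owner true _ = refl

C₋⇒odd : ∀ a n → 2 ℕ.≤ n → C₋ (segment a n) →
         ∃ λ k → n ≡ suc (suc k + suc k) × owner a 0 ≡ false
C₋⇒odd a n 2≤n (odd , diff) = let k , len = odd-length n 2≤n odd in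
  k , len , by-owner (owner a 0) (≡.trans (sym (imbalance a n k len)) diff)
  where
  by-owner : ∀ q → (if q then 1ℤ else -1ℤ) ≡ -1ℤ → q ≡ false
  by-owner false _ = refl

theorem20 : (a : ℤ) (n : ℕ) → 2 ≤ n → let G = segment a n in
    (C₌ G →
    (Ls G ≡ + 2 ⊎ Ls G ≡ + 4) ×
    (Rs G ≡ - (+ 2) ⊎ Rs G ≡ - (+ 4))) ×
    (C₋ G →
    (Ls G ≡ + 1 ⊎ Ls G ≡ + 3) ×
    (Rs G ≡ - (+ 1) ⊎ Rs G ≡ - (+ 3) ⊎ Rs G ≡ - (+ 5)) ×
    (¬ 2 ∣ ∣ L G ∣ → Ls G ≡ + 3)) ×
    (C₊ G →
    (Ls G ≡ + 1 ⊎ Ls G ≡ + 3 ⊎ Ls G ≡ + 5) ×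
    (Rs G ≡ - (+ 1) ⊎ Rs G ≡ - (+ 3)) ×
    (2 ∣ ∣ L G ∣ → Rs G ≡ - (+ 3)))
theorem20 a n 2≤n =
  (λ c₌ → let k , len = C₌⇒even a n c₌ in
     even-segment a k len 2≤n true ,
     Sum.map neg-≡ neg-≡ (even-segment a k len 2≤n false)) ,
  (λ c₋ → let k , len , o = C₋⇒odd a n 2≤n c₋ in
     odd-segment-opponent a k len 2≤n false o ,
     Sum.map neg-≡ (Sum.map neg-≡ neg-≡) (odd-segment-owner a k len 2≤n false o) ,
     -- Right owns the ends, so `L` has `suc k` vertices and is odd exactly when `k` is even.
     λ L-odd → odd-segment-opponent-3 a k len 2≤n false o
       ([ id , (λ d → contradiction (subst (2 ∣_) (sym (card-opponent a n k len true o)) d) L-odd) ]′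
         (2∣n⊎2∣1+n k))) ,
  (λ c₊ → let k , len , o = C₊⇒odd a n 2≤n c₊ in
     odd-segment-owner a k len 2≤n true o ,
     Sum.map neg-≡ neg-≡ (odd-segment-opponent a k len 2≤n true o) ,
     -- Left owns the ends, so `L` has `2 + k` vertices, of the same parity as `k`.
     λ L-even → neg-≡ (odd-segment-opponent-3 a k len 2≤n true o
       (ℕ.∣m+n∣m⇒∣n (subst (2 ∣_) (card-owner a n k len true o) L-even) ℕ.∣-refl)))
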